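{- Let $P$ be a set of prime numbers, $G$ a pro-$P$ group, $\Omega\cong\mathbb Z_P=\prod_{p\in P}\mathbb Z_p$ with a fixed topological generator $\omega$, and $d:G\to\Omega$ a surjective continuous homomorphism. Let $H$ be an inertially finite subgroup of $G$. The following holds: (i) The set $\mathrm{Frob}_H=\{h\in H\mid d_H(h)\in\Omega^+\}=d_H^{ -1}(\Omega^+)$ is a dense sub-semigroup of $H$. (ii) Let $U$ be an open normal subgroup of $H$ and let $q:H\to H/U$ be the quotient morphism. Then the semigroup morphism $q|_{\mathrm{Frob}_H}:\mathrm{Frob}_H\to H/U$ is surjective.
   Context: For a closed subgroup $H$ of $G$ put $f_H=[\Omega:d(H)]$; $H$ is inertially finite if it is closed and $f_H<\infty$. In this case $d(H)=f_H\Omega$ and $d_H=\frac1{f_H}d|_H:H\to\Omega$ (well defined since $\Omega$ is torsion-free) is surjective. $\Omega^+=\{n\omega:n\in\mathbb N_{>0}\}$. -}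

module Defs where

open import Algebra.Bundles using (Group; AbelianGroup; CommutativeMonoid; Semigroup)
open import Algebra.Morphism.Structures using (module GroupMorphisms)
import Algebra.Definitions.RawMonoid as RawMonoidDefinitions
import Algebra.Properties.AbelianGroup as AbelianGroupProperties
import Algebra.Properties.CommutativeMonoid.Mult as Mult
import Algebra.Properties.CommutativeMonoid.Sum as Sum
import Algebra.Properties.Group as GroupProperties
open import Data.Empty using (⊥; ⊥-elim; ⊥-elim-irr)
open import Data.Fin.Base as Fin using (Fin; toℕ; fromℕ<)
import Data.Fin.Properties as Fin
open import Data.Fin.Permutation using (Permutation; permutation)
open import Data.Integer.Base as ℤ using (ℤ; +_)
import Data.Integer.Coprimality as ℤ
import Data.Integer.Properties as ℤ
open import Data.Integer.Divisibility.Signed as ℤ using (divides; ∣ᵤ⇒∣; ∣⇒∣ᵤ)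
open import Data.Integer.Tactic.RingSolver using (solve-∀)
open import Data.Irrelevant using ([_])
open import Data.List.Base using (List; []; _∷_; _++_; map)
open import Data.List.Membership.Propositional using (_∈_)
open import Data.List.Relation.Unary.Any using (here; there)
open import Data.Nat.Base as ℕ using (ℕ; zero; suc; _<_; _^_; NonZero)
open import Data.Nat.Coprimality using (Coprime; coprime-Bézout; coprime-divisor)
import Data.Nat.DivMod as ℕ
open import Data.Nat.Divisibility as ℕ using ()
open import Data.Nat.GCD using (module Bézout)
open import Data.Nat.Induction using (<-rec)
open import Data.Nat.Primality using (Prime; prime?; prime⇒nonZero; prime⇒nonTrivial; prime⇒irreducible)
import Data.Nat.Properties as ℕ
open import Data.Product.Base using (Σ; Σ-syntax; ∃; _×_; _,_; proj₁; proj₂)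
open import Data.Refinement using (Refinement; _,_; value)
open import Data.Sum.Base using (_⊎_; inj₁; inj₂)
open import Data.Unit.Polymorphic.Base using (⊤; tt)
open import Function.Base using (_∘_; id)
open import Function.Bundles using (Bijection; module Bijection)
open import Function.Definitions using (Surjective)
open import Level using (Level; _⊔_; 0ℓ; Lift; lift; lower) renaming (suc to lsuc)
open import Relation.Binary.Bundles using (Setoid)
open import Relation.Binary.Core using (Rel)
open import Relation.Binary.Definitions using (_Respects_)
open import Relation.Binary.Structures using (IsPreorder)
open import Relation.Binary.PropositionalEquality as ≡ using (_≡_; _≢_)
import Relation.Binary.Reasoning.Setoid as SetoidReasoning
open import Relation.Nullary using (¬_; Dec; yes; no; contradiction)
open import Relation.Nullary.Decidable using (recompute; decidable-stable; ¬¬-excluded-middle)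
open import Relation.Unary using (Pred; _∩_; ⋃; ∁; _≐_; _⊆_)

private
  variable
    a b c c′ ℓ ℓ′ o p i s h : Level

-- Subsets are predicates, and "open" is a predicate on subsets at the
-- fixed level o; correspondingly unions range over index types in Set o.
-- Sets are setoids, so open sets are required to respect _≈_.

record TopologicalGroup c ℓ o : Set (lsuc (c ⊔ ℓ ⊔ lsuc o)) where
  field
    group : Group c ℓ
  open Group group public
  field
    IsOpen       : Pred (Pred Carrier o) (c ⊔ ℓ ⊔ lsuc o)
    open-resp-≈  : ∀ {V} → IsOpen V → V Respects _≈_
    open-resp-≐  : ∀ {V W} → V ≐ W → IsOpen V → IsOpen W
    open-⊤       : IsOpen (λ _ → ⊤)
    open-∩       : ∀ {V W} → IsOpen V → IsOpen W → IsOpen (V ∩ W)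
    open-⋃       : (I : Set o) (V : I → Pred Carrier o) →
                   (∀ i → IsOpen (V i)) → IsOpen (⋃ I V)
    ∙-continuous : ∀ {V} → IsOpen V → ∀ x y → V (x ∙ y) →
                   Σ[ A ∈ Pred Carrier o ] Σ[ B ∈ Pred Carrier o ]
                     IsOpen A × IsOpen B × A x × B y ×
                     (∀ {x′ y′} → A x′ → B y′ → V (x′ ∙ y′))
    ⁻¹-continuous : ∀ {V} → IsOpen V → IsOpen (λ x → V (x ⁻¹))

  IsClosed : Pred (Pred Carrier o) (c ⊔ ℓ ⊔ lsuc o)
  IsClosed A = IsOpen (∁ A)

  IsDense : Pred Carrier a → Set (a ⊔ c ⊔ ℓ ⊔ lsuc o)
  IsDense A = ∀ V → IsOpen V → ∀ x → V x → ∃ λ y → V y × A y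

  -- n · x is the n-fold product x ∙ … ∙ x, written additively.
  infixr 8 _·_
  _·_ : ℕ → Carrier → Carrier
  _·_ = RawMonoidDefinitions._×_ rawMonoid

  -- The subgroup of integer multiples of ω is dense.
  IsTopologicalGenerator : Carrier → Set (c ⊔ ℓ ⊔ lsuc o)
  IsTopologicalGenerator ω =
    IsDense (λ x → ∃ λ n → (x ≈ n · ω) ⊎ (x ≈ (n · ω) ⁻¹))

  PositiveMultiple : Carrier → Pred Carrier ℓ
  PositiveMultiple ω x = ∃ λ n → 0 < n × x ≈ n · ω

record ContinuousHom (G : TopologicalGroup c ℓ o) (H : TopologicalGroup c′ ℓ′ o) :
       Set (c ⊔ ℓ ⊔ c′ ⊔ ℓ′ ⊔ lsuc o) where
  private
    module G = TopologicalGroup G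
    module H = TopologicalGroup H
  field
    to         : G.Carrier → H.Carrier
    isHom      : GroupMorphisms.IsGroupHomomorphism G.rawGroup H.rawGroup to
    continuous : ∀ {V} → H.IsOpen V → G.IsOpen (V ∘ to)
  open GroupMorphisms.IsGroupHomomorphism isHom public

infix 4 _≅_
record _≅_ (G : TopologicalGroup c ℓ o) (H : TopologicalGroup c′ ℓ′ o) :
           Set (c ⊔ ℓ ⊔ c′ ⊔ ℓ′ ⊔ lsuc o) where
  private
    module G = TopologicalGroup G
    module H = TopologicalGroup H
  field
    iso     : ContinuousHom G H
    iso⁻¹   : ContinuousHom H G
  open ContinuousHom iso public using (to)
  open ContinuousHom iso⁻¹ public using () renaming (to to from)
  field
    from∘to : ∀ x → from (to x) G.≈ x
    to∘from : ∀ y → to (from y) H.≈ y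

record Subgroup (G : Group c ℓ) s : Set (c ⊔ ℓ ⊔ lsuc s) where
  open Group G
  field
    Member    : Pred Carrier s
    resp      : Member Respects _≈_
    ε-closed  : Member ε
    ∙-closed  : ∀ {x y} → Member x → Member y → Member (x ∙ y)
    ⁻¹-closed : ∀ {x} → Member x → Member (x ⁻¹)

  IsNormal : Set (c ⊔ s)
  IsNormal = ∀ g {x} → Member x → Member ((g ∙ x) ∙ g ⁻¹)

subgroup : (G : Group c ℓ) → Subgroup G s → Group (c ⊔ s) ℓ
subgroup G S = record
  { Carrier = Σ Carrier Member
  ; _≈_     = λ x y → proj₁ x ≈ proj₁ y
  ; _∙_     = λ x y → proj₁ x ∙ proj₁ y , ∙-closed (proj₂ x) (proj₂ y)
  ; ε       = ε , ε-closed
  ; _⁻¹     = λ x → proj₁ x ⁻¹ , ⁻¹-closed (proj₂ x)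
  ; isGroup = record
    { isMonoid = record
      { isSemigroup = record
        { isMagma = record
          { isEquivalence = record { refl = refl ; sym = sym ; trans = trans }
          ; ∙-cong = ∙-cong }
        ; assoc = λ x y z → assoc (proj₁ x) (proj₁ y) (proj₁ z) }
      ; identity = (λ x → identityˡ (proj₁ x)) , (λ x → identityʳ (proj₁ x)) }
    ; inverse = (λ x → inverseˡ (proj₁ x)) , (λ x → inverseʳ (proj₁ x))
    ; ⁻¹-cong = ⁻¹-cong }
  }
  where
  open Group G
  open Subgroup S

module _ (G : Group c ℓ) (S : Subgroup G s) where
  open Group G
  open Subgroup S
  open GroupProperties G
  private module R = SetoidReasoning setoid

  _~_ : Rel Carrier s
  x ~ y = Member (x ⁻¹ ∙ y)

  private
    ≈⇒~ : ∀ {x y} → x ≈ y → x ~ y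
    ≈⇒~ {x} x≈y = resp (trans (sym (inverseˡ x)) (∙-congˡ x≈y)) ε-closed

    ~-sym : ∀ {x y} → x ~ y → y ~ x
    ~-sym {x} {y} x~y = resp
      (trans (⁻¹-anti-homo-∙ (x ⁻¹) y) (∙-congˡ (⁻¹-involutive x))) (⁻¹-closed x~y)

    cancel-mid : ∀ x y z → (x ∙ y) ∙ (y ⁻¹ ∙ z) ≈ x ∙ z
    cancel-mid x y z = R.begin
      (x ∙ y) ∙ (y ⁻¹ ∙ z)   R.≈⟨ assoc x y _ ⟩
      x ∙ (y ∙ (y ⁻¹ ∙ z))   R.≈⟨ ∙-congˡ (sym (assoc y _ z)) ⟩
      x ∙ ((y ∙ y ⁻¹) ∙ z)   R.≈⟨ ∙-congˡ (∙-congʳ (inverseʳ y)) ⟩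
      x ∙ (ε ∙ z)            R.≈⟨ ∙-congˡ (identityˡ z) ⟩
      x ∙ z                  R.∎

    ~-trans : ∀ {x y z} → x ~ y → y ~ z → x ~ z
    ~-trans {x} {y} {z} x~y y~z = resp (cancel-mid (x ⁻¹) y z) (∙-closed x~y y~z)

  -- The set G/S of left cosets: two elements are identified when they lie
  -- in the same coset.
  cosets : Setoid c s
  cosets = record
    { Carrier = Carrier
    ; _≈_ = _~_
    ; isEquivalence = record { refl = ≈⇒~ refl ; sym = ~-sym ; trans = ~-trans }
    }

  module _ (normal : IsNormal) where
    private
      conj : ∀ g {x} → Member x → Member ((g ⁻¹ ∙ x) ∙ g)
      conj g m = resp (∙-congˡ (⁻¹-involutive g)) (normal (g ⁻¹) m)

      ~-∙ : ∀ {x x′ y y′} → x ~ x′ → y ~ y′ → (x ∙ y) ~ (x′ ∙ y′)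
      ~-∙ {x} {x′} {y} {y′} x~x′ y~y′ = resp eq (∙-closed (conj y x~x′) y~y′)
        where
        eq : ((y ⁻¹ ∙ (x ⁻¹ ∙ x′)) ∙ y) ∙ (y ⁻¹ ∙ y′) ≈ (x ∙ y) ⁻¹ ∙ (x′ ∙ y′)
        eq = R.begin
          ((y ⁻¹ ∙ (x ⁻¹ ∙ x′)) ∙ y) ∙ (y ⁻¹ ∙ y′) R.≈⟨ cancel-mid _ y y′ ⟩
          (y ⁻¹ ∙ (x ⁻¹ ∙ x′)) ∙ y′                R.≈⟨ ∙-congʳ (sym (assoc _ _ _)) ⟩
          ((y ⁻¹ ∙ x ⁻¹) ∙ x′) ∙ y′                R.≈⟨ assoc _ _ _ ⟩
          (y ⁻¹ ∙ x ⁻¹) ∙ (x′ ∙ y′)                R.≈⟨ ∙-congʳ (sym (⁻¹-anti-homo-∙ x y)) ⟩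
          (x ∙ y) ⁻¹ ∙ (x′ ∙ y′)                   R.∎

      ~-⁻¹ : ∀ {x y} → x ~ y → (x ⁻¹) ~ (y ⁻¹)
      ~-⁻¹ {x} {y} x~y = resp eq (normal y (~-sym x~y))
        where
        eq : (y ∙ (y ⁻¹ ∙ x)) ∙ y ⁻¹ ≈ x ⁻¹ ⁻¹ ∙ y ⁻¹
        eq = R.begin
          (y ∙ (y ⁻¹ ∙ x)) ∙ y ⁻¹ R.≈⟨ ∙-congʳ (sym (assoc _ _ _)) ⟩
          ((y ∙ y ⁻¹) ∙ x) ∙ y ⁻¹ R.≈⟨ ∙-congʳ (∙-congʳ (inverseʳ y)) ⟩
          (ε ∙ x) ∙ y ⁻¹          R.≈⟨ ∙-congʳ (identityˡ x) ⟩
          x ∙ y ⁻¹                R.≈⟨ ∙-congʳ (sym (⁻¹-involutive x)) ⟩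
          x ⁻¹ ⁻¹ ∙ y ⁻¹          R.∎

    quotient : Group c s
    quotient = record
      { Carrier = Carrier
      ; _≈_ = _~_
      ; _∙_ = _∙_
      ; ε = ε
      ; _⁻¹ = _⁻¹
      ; isGroup = record
        { isMonoid = record
          { isSemigroup = record
            { isMagma = record
              { isEquivalence = Setoid.isEquivalence cosets
              ; ∙-cong = ~-∙ }
            ; assoc = λ x y z → ≈⇒~ (assoc x y z) }
          ; identity = (λ x → ≈⇒~ (identityˡ x)) , (λ x → ≈⇒~ (identityʳ x)) }
        ; inverse = (λ x → ≈⇒~ (inverseˡ x)) , (λ x → ≈⇒~ (inverseʳ x))
        ; ⁻¹-cong = ~-⁻¹ }
      }

    -- Cosets are represented by their elements, so the quotient morphism
    -- is the identity on representatives.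
    quotientMap : Carrier → Group.Carrier quotient
    quotientMap x = x

HasCardinality : Setoid a b → ℕ → Set (a ⊔ b)
HasCardinality A n = Bijection (≡.setoid (Fin n)) A

HasIndex : (G : Group c ℓ) → Subgroup G s → ℕ → Set (c ⊔ s)
HasIndex G S n = HasCardinality (cosets G S) n

image : {G : TopologicalGroup c ℓ o} {H : TopologicalGroup c′ ℓ′ o} →
        ContinuousHom G H → Subgroup (TopologicalGroup.group G) s →
        Subgroup (TopologicalGroup.group H) (c ⊔ s ⊔ ℓ′)
image {G = G} {H = H} φ S = record
  { Member    = λ y → ∃ λ x → S.Member x × to x H.≈ y
  ; resp      = λ y≈y′ (x , x∈S , eq) → x , x∈S , H.trans eq y≈y′
  ; ε-closed  = G.ε , S.ε-closed , ε-homo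
  ; ∙-closed  = λ (x , x∈S , eq) (x′ , x′∈S , eq′) →
      x G.∙ x′ , S.∙-closed x∈S x′∈S , H.trans (homo x x′) (H.∙-cong eq eq′)
  ; ⁻¹-closed = λ (x , x∈S , eq) →
      x G.⁻¹ , S.⁻¹-closed x∈S , H.trans (⁻¹-homo x) (H.⁻¹-cong eq)
  }
  where
  module G = TopologicalGroup G
  module H = TopologicalGroup H
  module S = Subgroup S
  open ContinuousHom φ

-- A subgroup with the subspace topology.
subgroupᵗ : (G : TopologicalGroup c ℓ o) → Subgroup (TopologicalGroup.group G) s →
            TopologicalGroup (c ⊔ s) ℓ o
subgroupᵗ {o = o} G S = record
  { group         = subgroup group S
  ; IsOpen        = λ W → Σ[ V ∈ Pred Carrier o ] IsOpen V × (W ≐ V ∘ proj₁)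
  ; open-resp-≈   = λ (V , V-open , W⊆V , V⊆W) x≈y x∈W → V⊆W (open-resp-≈ V-open x≈y (W⊆V x∈W))
  ; open-resp-≐   = λ (W⊆W′ , W′⊆W) (V , V-open , W⊆V , V⊆W) →
      V , V-open , (λ x∈W′ → W⊆V (W′⊆W x∈W′)) , (λ x∈V → W⊆W′ (V⊆W x∈V))
  ; open-⊤        = (λ _ → ⊤) , open-⊤ , id , id
  ; open-∩        = λ (V , V-open , W⊆V , V⊆W) (V′ , V′-open , W′⊆V′ , V′⊆W′) →
      V ∩ V′ , open-∩ V-open V′-open
      , (λ (x∈W , x∈W′) → W⊆V x∈W , W′⊆V′ x∈W′) , (λ (x∈V , x∈V′) → V⊆W x∈V , V′⊆W′ x∈V′)
  ; open-⋃        = λ I W W-open →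
      ⋃ I (λ i → proj₁ (W-open i)) , open-⋃ I _ (λ i → proj₁ (proj₂ (W-open i)))
      , (λ (i , x∈W) → i , proj₁ (proj₂ (proj₂ (W-open i))) x∈W)
      , (λ (i , x∈V) → i , proj₂ (proj₂ (proj₂ (W-open i))) x∈V)
  ; ∙-continuous  = λ (V , V-open , W⊆V , V⊆W) x y xy∈W →
      let (A , B , A-open , B-open , x∈A , y∈B , AB⊆V) =
            ∙-continuous V-open (proj₁ x) (proj₁ y) (W⊆V xy∈W)
      in A ∘ proj₁ , B ∘ proj₁ , (A , A-open , id , id) , (B , B-open , id , id)
         , x∈A , y∈B , (λ x′∈A y′∈B → V⊆W (AB⊆V x′∈A y′∈B))
  ; ⁻¹-continuous = λ (V , V-open , W⊆V , V⊆W) → _ , ⁻¹-continuous V-open , W⊆V , V⊆W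
  }
  where open TopologicalGroup G

-- The relation _≈_ is taken at level 0ℓ so that singletons are subsets at
-- any level o.
discrete : Group c 0ℓ → ∀ o → TopologicalGroup c 0ℓ o
discrete {c} G o = record
  { group         = G
  ; IsOpen        = λ V → Lift (c ⊔ lsuc o) (V Respects _≈_)
  ; open-resp-≈   = lower
  ; open-resp-≐   = λ (V⊆W , W⊆V) (lift r) → lift (λ x≈y x∈W → V⊆W (r x≈y (W⊆V x∈W)))
  ; open-⊤        = lift (λ _ _ → tt)
  ; open-∩        = λ (lift r) (lift r′) → lift (λ x≈y (x∈V , x∈W) → r x≈y x∈V , r′ x≈y x∈W)
  ; open-⋃        = λ I V r → lift (λ x≈y (i , x∈V) → i , lower (r i) x≈y x∈V)
  ; ∙-continuous  = λ (lift r) x y xy∈V →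
      (λ x′ → Lift o (x ≈ x′)) , (λ y′ → Lift o (y ≈ y′))
      , lift (λ x′≈x″ (lift x≈x′) → lift (trans x≈x′ x′≈x″))
      , lift (λ y′≈y″ (lift y≈y′) → lift (trans y≈y′ y′≈y″))
      , lift refl , lift refl , (λ (lift x≈x′) (lift y≈y′) → r (∙-cong x≈x′ y≈y′) xy∈V)
  ; ⁻¹-continuous = λ (lift r) → lift (λ x≈y → r (⁻¹-cong x≈y))
  }
  where open Group G

module _ {I : Set i} (X : I → TopologicalGroup c ℓ o) where
  private
    module X j = TopologicalGroup (X j)

  -- The basic open sets of the product topology, as finite intersections
  -- of preimages of open sets under the projections.
  Box : Set (i ⊔ c ⊔ ℓ ⊔ lsuc o)
  Box = List (Σ[ j ∈ I ] Σ[ V ∈ Pred (X.Carrier j) o ] X.IsOpen j V)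

  ⟦_⟧ : Box → Pred (∀ j → X.Carrier j) o
  ⟦ [] ⟧              x = ⊤
  ⟦ (j , V , _) ∷ F ⟧ x = V (x j) × ⟦ F ⟧ x

  private
    IsOpenΠ : Pred (Pred (∀ j → X.Carrier j) o) (i ⊔ c ⊔ ℓ ⊔ lsuc o)
    IsOpenΠ W = ∀ x → W x → Σ[ F ∈ Box ] ⟦ F ⟧ x × (∀ {y} → ⟦ F ⟧ y → W y)

    box-resp : ∀ F {x y} → (∀ j → X._≈_ j (x j) (y j)) → ⟦ F ⟧ x → ⟦ F ⟧ y
    box-resp []                   x≈y _           = tt
    box-resp ((j , V , V-open) ∷ F) x≈y (x∈V , x∈F) =
      X.open-resp-≈ j V-open (x≈y j) x∈V , box-resp F x≈y x∈F

    box-++⁺ : ∀ F F′ {x} → ⟦ F ⟧ x → ⟦ F′ ⟧ x → ⟦ F ++ F′ ⟧ x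
    box-++⁺ []      F′ _           x∈F′ = x∈F′
    box-++⁺ (_ ∷ F) F′ (x∈V , x∈F) x∈F′ = x∈V , box-++⁺ F F′ x∈F x∈F′

    box-++⁻ : ∀ F F′ {x} → ⟦ F ++ F′ ⟧ x → ⟦ F ⟧ x × ⟦ F′ ⟧ x
    box-++⁻ []      F′ x∈F′        = tt , x∈F′
    box-++⁻ (_ ∷ F) F′ (x∈V , x∈)  =
      let (x∈F , x∈F′) = box-++⁻ F F′ x∈ in (x∈V , x∈F) , x∈F′

    box-∙ : ∀ F x y → ⟦ F ⟧ (λ j → X._∙_ j (x j) (y j)) →
            Σ[ A ∈ Box ] Σ[ B ∈ Box ] ⟦ A ⟧ x × ⟦ B ⟧ y ×
              (∀ {x′ y′} → ⟦ A ⟧ x′ → ⟦ B ⟧ y′ → ⟦ F ⟧ (λ j → X._∙_ j (x′ j) (y′ j)))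
    box-∙ []                     x y _           = [] , [] , tt , tt , (λ _ _ → tt)
    box-∙ ((j , V , V-open) ∷ F) x y (xy∈V , xy∈F) =
      let (As , Bs , x∈As , y∈Bs , AsBs⊆F) = box-∙ F x y xy∈F
          (A , B , A-open , B-open , x∈A , y∈B , AB⊆V) = X.∙-continuous j V-open (x j) (y j) xy∈V
      in (j , A , A-open) ∷ As , (j , B , B-open) ∷ Bs , (x∈A , x∈As) , (y∈B , y∈Bs)
         , (λ (x′∈A , x′∈As) (y′∈B , y′∈Bs) → AB⊆V x′∈A y′∈B , AsBs⊆F x′∈As y′∈Bs)

    box-⁻¹ : Box → Box
    box-⁻¹ = map (λ (j , V , V-open) → j , _ , X.⁻¹-continuous j V-open)

    box-⁻¹⁺ : ∀ F {x} → ⟦ F ⟧ (λ j → X._⁻¹ j (x j)) → ⟦ box-⁻¹ F ⟧ x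
    box-⁻¹⁺ []      _           = tt
    box-⁻¹⁺ (_ ∷ F) (x∈V , x∈F) = x∈V , box-⁻¹⁺ F x∈F

    box-⁻¹⁻ : ∀ F {x} → ⟦ box-⁻¹ F ⟧ x → ⟦ F ⟧ (λ j → X._⁻¹ j (x j))
    box-⁻¹⁻ []      _           = tt
    box-⁻¹⁻ (_ ∷ F) (x∈V , x∈F) = x∈V , box-⁻¹⁻ F x∈F

  ∏ : TopologicalGroup (i ⊔ c) (i ⊔ ℓ) o
  ∏ = record
    { group = record
      { Carrier = ∀ j → X.Carrier j
      ; _≈_     = λ x y → ∀ j → X._≈_ j (x j) (y j)
      ; _∙_     = λ x y j → X._∙_ j (x j) (y j)
      ; ε       = λ j → X.ε j
      ; _⁻¹     = λ x j → X._⁻¹ j (x j)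
      ; isGroup = record
        { isMonoid = record
          { isSemigroup = record
            { isMagma = record
              { isEquivalence = record
                { refl  = λ j → X.refl j
                ; sym   = λ x≈y j → X.sym j (x≈y j)
                ; trans = λ x≈y y≈z j → X.trans j (x≈y j) (y≈z j) }
              ; ∙-cong = λ x≈x′ y≈y′ j → X.∙-cong j (x≈x′ j) (y≈y′ j) }
            ; assoc = λ x y z j → X.assoc j (x j) (y j) (z j) }
          ; identity = (λ x j → X.identityˡ j (x j)) , (λ x j → X.identityʳ j (x j)) }
        ; inverse = (λ x j → X.inverseˡ j (x j)) , (λ x j → X.inverseʳ j (x j))
        ; ⁻¹-cong = λ x≈y j → X.⁻¹-cong j (x≈y j) }
      }
    ; IsOpen        = IsOpenΠ
    ; open-resp-≈   = λ W-open {x} {y} x≈y x∈W →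
        let (F , x∈F , F⊆W) = W-open x x∈W in F⊆W (box-resp F x≈y x∈F)
    ; open-resp-≐   = λ (V⊆W , W⊆V) V-open x x∈W →
        let (F , x∈F , F⊆V) = V-open x (W⊆V x∈W) in F , x∈F , (λ y∈F → V⊆W (F⊆V y∈F))
    ; open-⊤        = λ _ _ → [] , tt , id
    ; open-∩        = λ V-open W-open x (x∈V , x∈W) →
        let (F , x∈F , F⊆V) = V-open x x∈V
            (F′ , x∈F′ , F′⊆W) = W-open x x∈W
        in F ++ F′ , box-++⁺ F F′ x∈F x∈F′
           , (λ y∈ → let (y∈F , y∈F′) = box-++⁻ F F′ y∈ in F⊆V y∈F , F′⊆W y∈F′)
    ; open-⋃        = λ J V V-open x (j , x∈V) →
        let (F , x∈F , F⊆V) = V-open j x x∈V in F , x∈F , (λ y∈F → j , F⊆V y∈F)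
    ; ∙-continuous  = λ W-open x y xy∈W →
        let (F , xy∈F , F⊆W) = W-open _ xy∈W
            (A , B , x∈A , y∈B , AB⊆F) = box-∙ F x y xy∈F
        in ⟦ A ⟧ , ⟦ B ⟧ , (λ _ z∈A → A , z∈A , id) , (λ _ z∈B → B , z∈B , id)
           , x∈A , y∈B , (λ x′∈A y′∈B → F⊆W (AB⊆F x′∈A y′∈B))
    ; ⁻¹-continuous = λ W-open x x∈W →
        let (F , x∈F , F⊆W) = W-open _ x∈W
        in box-⁻¹ F , box-⁻¹⁺ F x∈F , (λ y∈F → F⊆W (box-⁻¹⁻ F y∈F))
    }

-- Inverse systems of groups over a directed preordered set.  Functoriality
-- is stated for arbitrary proofs of j ≤ k, so transition maps do not depend
-- on the proof.
record InverseSystem i : Set (lsuc i ⊔ lsuc 0ℓ) where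
  field
    Index      : Set i
    _≤_        : Rel Index i
    isPreorder : IsPreorder _≡_ _≤_
    inhabitant : Index
    directed   : ∀ j k → ∃ λ l → j ≤ l × k ≤ l
    obj        : Index → Group 0ℓ 0ℓ
  module Obj j = Group (obj j)
  field
    φ      : ∀ {j k} → j ≤ k → Obj.Carrier k → Obj.Carrier j
    φ-hom  : ∀ {j k} (j≤k : j ≤ k) →
             GroupMorphisms.IsGroupHomomorphism (Obj.rawGroup k) (Obj.rawGroup j) (φ j≤k)
    φ-id   : ∀ {j} (j≤j : j ≤ j) x → Obj._≈_ j (φ j≤j x) x
    φ-comp : ∀ {j k l} (j≤k : j ≤ k) (k≤l : k ≤ l) (j≤l : j ≤ l) x →
             Obj._≈_ j (φ j≤k (φ k≤l x)) (φ j≤l x)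

  -- The compatible families in the product of the (discrete) groups.
  compatible : ∀ o → Subgroup (TopologicalGroup.group (∏ (λ j → discrete (obj j) o))) i
  compatible o = record
    { Member    = λ x → ∀ {j k} (j≤k : j ≤ k) → Obj._≈_ j (φ j≤k (x k)) (x j)
    ; resp      = λ x≈y cx {j} {k} j≤k → Obj.trans j
        (Hom.⟦⟧-cong j≤k (Obj.sym k (x≈y k))) (Obj.trans j (cx j≤k) (x≈y j))
    ; ε-closed  = λ j≤k → Hom.ε-homo j≤k
    ; ∙-closed  = λ cx cy {j} j≤k → Obj.trans j
        (Hom.homo j≤k _ _) (Obj.∙-cong j (cx j≤k) (cy j≤k))
    ; ⁻¹-closed = λ cx {j} j≤k → Obj.trans j (Hom.⁻¹-homo j≤k _) (Obj.⁻¹-cong j (cx j≤k))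
    }
    where
    module Hom {j k} (j≤k : j ≤ k) = GroupMorphisms.IsGroupHomomorphism (φ-hom j≤k)

  limit : ∀ o → TopologicalGroup i i o
  limit o = subgroupᵗ (∏ (λ j → discrete (obj j) o)) (compatible o)

-- n is a product of primes from P.
IsNumberOver : Pred ℕ p → Pred ℕ p
IsNumberOver P n = 0 < n × (∀ q → Prime q → q ℕ.∣ n → P q)

-- An inverse limit of finite groups whose orders are products of primes
-- from P.
record IsPro (P : Pred ℕ p) (G : TopologicalGroup c ℓ o) i : Set (p ⊔ c ⊔ ℓ ⊔ lsuc o ⊔ lsuc i) where
  field
    system : InverseSystem i
  open InverseSystem system
  field
    finite  : ∀ j → ∃ λ n → HasCardinality (Obj.setoid j) n × IsNumberOver P n
    isLimit : G ≅ limit o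

ℤ⁺ : Group 0ℓ 0ℓ
ℤ⁺ = AbelianGroup.group ℤ.+-0-abelianGroup

multiples : ℕ → Subgroup ℤ⁺ 0ℓ
multiples m = record
  { Member    = λ x → + m ℤ.∣ x
  ; resp      = λ { ≡.refl → id }
  ; ε-closed  = divides (+ 0) ≡.refl
  ; ∙-closed  = ℤ.∣m∣n⇒∣m+n
  ; ⁻¹-closed = ℤ.∣m⇒∣-m
  }

ℤ/ : ℕ → Group 0ℓ 0ℓ
ℤ/ m = quotient ℤ⁺ (multiples m) normal
  where
  cancel : ∀ g x → x ≡ (g ℤ.+ x) ℤ.+ ℤ.- g
  cancel = solve-∀
  normal : Subgroup.IsNormal (multiples m)
  normal g {x} = ≡.subst (+ m ℤ.∣_) (cancel g x)

^-∣ : ∀ q {m n} → m ℕ.≤ n → q ^ m ℕ.∣ q ^ n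
^-∣ q {m} m≤n with k , ≡.refl ← ℕ.m≤n⇒∃[o]m+o≡n m≤n =
    ℕ.divides (q ^ k) (≡.trans (ℕ.^-distribˡ-+-* q m k) (ℕ.*-comm (q ^ m) (q ^ k)))

-- … → ℤ/p² → ℤ/p → ℤ/1
p-adicSystem : ℕ → InverseSystem 0ℓ
p-adicSystem q = record
  { Index      = ℕ
  ; _≤_        = ℕ._≤_
  ; isPreorder = ℕ.≤-isPreorder
  ; inhabitant = 0
  ; directed   = λ m n → m ℕ.⊔ n , ℕ.m≤m⊔n m n , ℕ.m≤n⊔m m n
  ; obj        = λ n → ℤ/ (q ^ n)
  ; φ          = λ _ x → x
  ; φ-hom      = λ {m} m≤n → record
    { isMonoidHomomorphism = record
      { isMagmaHomomorphism = record
        { isRelHomomorphism = record { cong = ℤ.∣-trans (∣ᵤ⇒∣ (^-∣ q m≤n)) }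
        ; homo = λ x y → Group.refl (ℤ/ (q ^ m)) {x ℤ.+ y} }
      ; ε-homo = Group.refl (ℤ/ (q ^ m)) {+ 0} }
    ; ⁻¹-homo = λ x → Group.refl (ℤ/ (q ^ m)) {ℤ.- x} }
  ; φ-id       = λ {m} _ x → Group.refl (ℤ/ (q ^ m)) {x}
  ; φ-comp     = λ {m} _ _ _ x → Group.refl (ℤ/ (q ^ m)) {x}
  }

ℤ[_] : ℕ → ∀ o → TopologicalGroup 0ℓ 0ℓ o
ℤ[ q ] o = InverseSystem.limit (p-adicSystem q) o

-- Refinement makes the proof of membership in P irrelevant, so that every
-- prime in P contributes exactly one factor.
ℤ⟨_⟩ : Pred ℕ p → ∀ o → TopologicalGroup p p o
ℤ⟨ P ⟩ o = ∏ {I = Refinement ℕ P} (λ q → ℤ[ value q ] o)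

factor : ∀ q → Prime q → ∀ n → .{{NonZero n}} →
         Σ[ v ∈ ℕ ] Σ[ m ∈ ℕ ] n ≡ q ^ v ℕ.* m × ¬ (q ℕ.∣ m)
factor q pq n = <-rec _ step n
  where
  instance _ = prime⇒nonTrivial pq
  step : ∀ n → (∀ {k} → k < n → .{{NonZero k}} →
           Σ[ v ∈ ℕ ] Σ[ m ∈ ℕ ] k ≡ q ^ v ℕ.* m × ¬ (q ℕ.∣ m)) →
         .{{NonZero n}} → Σ[ v ∈ ℕ ] Σ[ m ∈ ℕ ] n ≡ q ^ v ℕ.* m × ¬ (q ℕ.∣ m)
  step n rec with q ℕ.∣? n
  ... | no  q∤n = 0 , n , ≡.sym (ℕ.*-identityˡ n) , q∤n
  ... | yes q∣n =
    let instance k≢0 = ℕ.quotient≢0 q∣n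
        (v , m , eq , q∤m) = rec (ℕ.quotient-< q∣n)
    in suc v , m
       , ≡.trans (ℕ.m∣n⇒n≡m*quotient q∣n)
           (≡.trans (≡.cong (q ℕ.*_) eq) (≡.sym (ℕ.*-assoc q (q ^ v) m)))
       , q∤m

coprime-^ : ∀ {q m} → Prime q → ¬ (q ℕ.∣ m) → ∀ n → Coprime (q ^ n) m
coprime-^ pq q∤m zero (d∣1 , _) = ℕ.∣1⇒≡1 d∣1
coprime-^ {q} {m} pq q∤m (suc n) {d} (d∣ , d∣m) =
  coprime-^ pq q∤m n (coprime-divisor d⊥q d∣ , d∣m)
  where
  d⊥q : Coprime d q
  d⊥q (e∣d , e∣q) with prime⇒irreducible pq e∣q
  ... | inj₁ e≡1    = e≡1
  ... | inj₂ ≡.refl = contradiction (ℕ.∣-trans e∣d d∣m) q∤m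

inverse-mod : ∀ {Q m} → Coprime Q m → ∃ λ a → + Q ℤ.∣ a ℤ.* + m ℤ.- + 1
inverse-mod {Q} {m} Q⊥m with coprime-Bézout Q⊥m
... | Bézout.+- x y eq = ℤ.- + y , divides (ℤ.- + x) (≡.trans (lemma (+ y) (+ m))
      (≡.trans (≡.cong ℤ.-_ (cast eq)) (ℤ.neg-distribˡ-* (+ x) (+ Q))))
  where
  lemma : ∀ y m → ℤ.- y ℤ.* m ℤ.- + 1 ≡ ℤ.- (+ 1 ℤ.+ y ℤ.* m)
  lemma = solve-∀
  cast : 1 ℕ.+ y ℕ.* m ≡ x ℕ.* Q → + 1 ℤ.+ + y ℤ.* + m ≡ + x ℤ.* + Q
  cast e = ≡.trans (≡.cong (λ w → + 1 ℤ.+ w) (≡.sym (ℤ.pos-* y m))) (≡.trans (≡.cong +_ e) (ℤ.pos-* x Q))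
... | Bézout.-+ x y eq = + y , divides (+ x) (≡.trans (≡.cong (ℤ._- + 1) (≡.sym (cast eq))) (lemma (+ x) (+ Q)))
  where
  lemma : ∀ x Q → (+ 1 ℤ.+ x ℤ.* Q) ℤ.- + 1 ≡ x ℤ.* Q
  lemma = solve-∀
  cast : 1 ℕ.+ x ℕ.* Q ≡ y ℕ.* m → + 1 ℤ.+ + x ℤ.* + Q ≡ + y ℤ.* + m
  cast e = ≡.trans (≡.cong (λ w → + 1 ℤ.+ w) (≡.sym (ℤ.pos-* x Q))) (≡.trans (≡.cong +_ e) (ℤ.pos-* y m))

p-adic-divide : ∀ q → Prime q → ∀ v m → ¬ (q ℕ.∣ m) →
  (z : ℕ → ℤ) → (∀ {j k} → j ℕ.≤ k → + (q ^ j) ℤ.∣ ℤ.- z k ℤ.+ z j) →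
  + (q ^ v) ℤ.∣ z v →
  Σ[ y ∈ (ℕ → ℤ) ] (∀ {j k} → j ℕ.≤ k → + (q ^ j) ℤ.∣ ℤ.- y k ℤ.+ y j) ×
    (∀ n → + (q ^ n) ℤ.∣ ℤ.- (+ (q ^ v ℕ.* m) ℤ.* y n) ℤ.+ z n)
p-adic-divide q pq v m q∤m z cz q^v∣z = y , cy , spec
  where
  instance
    q≢0 : NonZero q
    q≢0 = prime⇒nonZero pq
    q^v≢0 : NonZero (q ^ v)
    q^v≢0 = ℕ.m^n≢0 q v

  c∣ : ∀ n → + (q ^ v) ℤ.∣ z (n ℕ.+ v)
  c∣ n = ≡.subst (+ (q ^ v) ℤ.∣_) (lemma (z (n ℕ.+ v)) (z v))
           (ℤ.∣m∣n⇒∣m-n q^v∣z (cz (ℕ.m≤n+m v n)))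
    where
    lemma : ∀ a b → b ℤ.- (ℤ.- a ℤ.+ b) ≡ a
    lemma = solve-∀

  zq : ℕ → ℤ
  zq n = ℤ._∣_.quotient (c∣ n)

  a-inv : ∀ n → ∃ λ a → + (q ^ n) ℤ.∣ a ℤ.* + m ℤ.- + 1
  a-inv n = inverse-mod (coprime-^ pq q∤m n)

  y : ℕ → ℤ
  y n = proj₁ (a-inv n) ℤ.* zq n

  -- y n ≡ zq n / m  modulo qⁿ
  my : ∀ n → + (q ^ n) ℤ.∣ + m ℤ.* y n ℤ.- zq n
  my n = ≡.subst (+ (q ^ n) ℤ.∣_) (lemma (proj₁ (a-inv n)) (+ m) (zq n))
           (ℤ.∣m⇒∣m*n (zq n) (proj₂ (a-inv n)))
    where
    lemma : ∀ a m c → (a ℤ.* m ℤ.- + 1) ℤ.* c ≡ m ℤ.* (a ℤ.* c) ℤ.- c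
    lemma = solve-∀

  spec : ∀ n → + (q ^ n) ℤ.∣ ℤ.- (+ (q ^ v ℕ.* m) ℤ.* y n) ℤ.+ z n
  spec n = ≡.subst (+ (q ^ n) ℤ.∣_) eq
    (ℤ.∣m∣n⇒∣m+n (ℤ.∣n⇒∣m*n (ℤ.- + (q ^ v)) (my n)) (cz (ℕ.m≤m+n n v)))
    where
    lemma : ∀ Q m y c z → ℤ.- Q ℤ.* (m ℤ.* y ℤ.- c) ℤ.+ (ℤ.- (c ℤ.* Q) ℤ.+ z) ≡ ℤ.- ((Q ℤ.* m) ℤ.* y) ℤ.+ z
    lemma = solve-∀
    eq : ℤ.- + (q ^ v) ℤ.* (+ m ℤ.* y n ℤ.- zq n) ℤ.+ (ℤ.- z (n ℕ.+ v) ℤ.+ z n)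
         ≡ ℤ.- (+ (q ^ v ℕ.* m) ℤ.* y n) ℤ.+ z n
    eq = ≡.trans
      (≡.cong (λ w → ℤ.- + (q ^ v) ℤ.* (+ m ℤ.* y n ℤ.- zq n) ℤ.+ (ℤ.- w ℤ.+ z n)) (ℤ._∣_.equality (c∣ n)))
      (≡.trans (lemma (+ (q ^ v)) (+ m) (y n) (zq n) (z n))
        (≡.cong (λ w → ℤ.- (w ℤ.* y n) ℤ.+ z n) (≡.sym (ℤ.pos-* (q ^ v) m))))

  cc : ∀ {j k} → j ℕ.≤ k → + (q ^ j) ℤ.∣ ℤ.- zq k ℤ.+ zq j
  cc {j} {k} j≤k with divides r eq ← cz (ℕ.+-monoˡ-≤ v j≤k) =
    divides r (ℤ.*-cancelʳ-≡ (ℤ.- zq k ℤ.+ zq j) (r ℤ.* + (q ^ j)) (+ (q ^ v)) (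
      ≡.trans (lemma (zq k) (zq j) (+ (q ^ v))) (≡.trans (≡.cong₂ (λ a b → ℤ.- a ℤ.+ b) (≡.sym (ℤ._∣_.equality (c∣ k))) (≡.sym (ℤ._∣_.equality (c∣ j))))
        (≡.trans eq (≡.trans (≡.cong (λ w → r ℤ.* + w) (ℕ.^-distribˡ-+-* q j v)) (≡.trans (≡.cong (r ℤ.*_) (ℤ.pos-* (q ^ j) (q ^ v))) (≡.sym (ℤ.*-assoc r (+ (q ^ j)) (+ (q ^ v))))))))))
    where
    lemma : ∀ a b Q → (ℤ.- a ℤ.+ b) ℤ.* Q ≡ ℤ.- (a ℤ.* Q) ℤ.+ b ℤ.* Q
    lemma = solve-∀
  cy : ∀ {j k} → j ℕ.≤ k → + (q ^ j) ℤ.∣ ℤ.- y k ℤ.+ y j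
  cy {j} {k} j≤k = ∣ᵤ⇒∣ (ℤ.coprime-divisor (+ (q ^ j)) (+ m) _ (coprime-^ pq q∤m j)
    (∣⇒∣ᵤ (≡.subst (+ (q ^ j) ℤ.∣_) (lemma (+ m) (y j) (y k) (zq j) (zq k))
      (ℤ.∣m∣n⇒∣m+n (ℤ.∣m∣n⇒∣m-n (my j) (ℤ.∣-trans (∣ᵤ⇒∣ (^-∣ q j≤k)) (my k))) (cc j≤k)))))
    where
    lemma : ∀ m yj yk cj ck →
            ((m ℤ.* yj ℤ.- cj) ℤ.- (m ℤ.* yk ℤ.- ck)) ℤ.+ (ℤ.- ck ℤ.+ cj) ≡ m ℤ.* (ℤ.- yk ℤ.+ yj)
    lemma = solve-∀

module IndexDivision (A : AbelianGroup c ℓ) (S : Subgroup (AbelianGroup.group A) s)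
                     (f : ℕ) (card : HasIndex (AbelianGroup.group A) S f) where
  open AbelianGroup A
  open Subgroup S
  open GroupProperties group using (identityʳ-unique)
  open Mult commutativeMonoid renaming (_×_ to _·_)
  open AbelianGroupProperties A using (xyx⁻¹≈y)
  open SetoidReasoning setoid
  module C = Setoid (cosets group S)
  module B = Bijection card

  normal : IsNormal
  normal g {x} = resp (sym (xyx⁻¹≈y g x))

  Q : CommutativeMonoid c s
  Q = record
    { isCommutativeMonoid = record
      { isMonoid = Group.isMonoid (quotient group S normal)
      ; comm = λ x y → resp (trans (sym (inverseˡ (x ∙ y))) (∙-congˡ (comm x y))) ε-closed } }
  module Q = CommutativeMonoid Q
  module ΣQ = Sum Q
  module MQ = Mult Q

  ≈⇒C : ∀ {x y} → x ≈ y → x C.≈ y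
  ≈⇒C {x} x≈y = resp (trans (sym (inverseˡ x)) (∙-congˡ x≈y)) ε-closed

  C⇒∈ : ∀ {x} → C._≈_ ε x → Member x
  C⇒∈ {x} = resp (trans (∙-congʳ (GroupProperties.ε⁻¹≈ε group)) (identityˡ x))

  ∈⇒C : ∀ {x} → Member x → C._≈_ ε x
  ∈⇒C {x} = resp (sym (trans (∙-congʳ (GroupProperties.ε⁻¹≈ε group)) (identityˡ x)))

  class : Carrier → Fin f
  class x = proj₁ (B.surjective x)

  rep-class : ∀ x → B.to (class x) C.≈ x
  rep-class x = proj₂ (B.surjective x) ≡.refl

  class-cong : ∀ {x y} → x C.≈ y → class x ≡ class y
  class-cong {x} {y} x~y = B.injective {class x} {class y} (C.trans {B.to (class x)} {x} {B.to (class y)} (rep-class x)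
    (C.trans {x} {y} {B.to (class y)} x~y (C.sym {B.to (class y)} {y} (rep-class y))))

  class-inj : ∀ {x y} → class x ≡ class y → x C.≈ y
  class-inj {x} {y} eq = C.trans {x} {B.to (class x)} {y} (C.sym {B.to (class x)} {x} (rep-class x))
    (C.trans {B.to (class x)} {B.to (class y)} {y} (≡.subst (λ j → B.to (class x) C.≈ B.to j) eq (C.refl {B.to (class x)})) (rep-class y))

  class-rep : ∀ j → class (B.to j) ≡ j
  class-rep j = B.injective {class (B.to j)} {j} (rep-class (B.to j))

  translate : Carrier → Permutation f f
  translate x = permutation (shift x) (shift (x ⁻¹)) (there-back x (x ⁻¹) (inverseˡ x)) (there-back (x ⁻¹) x (inverseʳ x))
    where
    shift : Carrier → Fin f → Fin f
    shift x j = class (B.to j ∙ x)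
    there-back : ∀ x y → y ∙ x ≈ ε → ∀ j → shift x (shift y j) ≡ j
    there-back x y yx≈ε j = ≡.trans
      (class-cong (C.trans {B.to (class (B.to j ∙ y)) ∙ x} {(B.to j ∙ y) ∙ x} {B.to j}
        (Q.∙-cong {B.to (class (B.to j ∙ y))} {B.to j ∙ y} {x} {x} (rep-class (B.to j ∙ y)) (C.refl {x}))
        (≈⇒C (trans (assoc _ y x) (trans (∙-congˡ yx≈ε) (identityʳ _))))))
      (class-rep j)

  ×Q≡ : ∀ n x → n MQ.× x ≡ n · x
  ×Q≡ zero    x = ≡.refl
  ×Q≡ (suc n) x = ≡.cong (x ∙_) (×Q≡ n x)

  index-kills : ∀ x → Member (f · x)
  index-kills x = C⇒∈ (C.sym {f · x} {ε} (≡.subst (C._≈ ε) (×Q≡ f x)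
    (GroupProperties.identityʳ-unique (quotient group S normal) total (f MQ.× x)
      (C.sym {total} {total ∙ f MQ.× x} chain))))
    where
    total : Carrier
    total = ΣQ.sum B.to
    moved : Carrier
    moved = ΣQ.sum (λ j → B.to j ∙ x)
    chain : total C.≈ (total ∙ f MQ.× x)
    chain = C.trans {total} {moved} {total ∙ f MQ.× x}
      (C.trans {total} {ΣQ.sum (λ j → B.to (class (B.to j ∙ x)))} {moved}
        (ΣQ.sum-permute B.to (translate x))
        (ΣQ.sum-cong-≋ (λ j → rep-class (B.to j ∙ x))))
      (C.trans {moved} {total ∙ ΣQ.sum {f} (λ _ → x)} {total ∙ f MQ.× x}
        (ΣQ.∑-distrib-+ B.to (λ _ → x))
        (Q.∙-cong {total} {total} {ΣQ.sum {f} (λ _ → x)} {f MQ.× x} (C.refl {total}) (ΣQ.sum-replicate f)))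

  f≢0 : NonZero f
  f≢0 = Fin.nonZeroIndex (class ε)

  C-∙ : ∀ {x y} → Member y → x C.≈ (x ∙ y)
  C-∙ {x} {y} y∈S = C.trans {x} {x ∙ ε} {x ∙ y} (≈⇒C (sym (identityʳ x)))
    (Q.∙-cong {x} {x} {ε} {y} (C.refl {x}) (∈⇒C y∈S))

  ·-closed : ∀ n {x} → Member x → Member (n · x)
  ·-closed zero    x∈S = ε-closed
  ·-closed (suc n) x∈S = ∙-closed x∈S (·-closed n x∈S)

  divMod· : ∀ k r .{{_ : NonZero r}} x → k · x ≈ (k ℕ.% r) · x ∙ r · ((k ℕ./ r) · x)
  divMod· k r x = begin
    k · x                                    ≈⟨ ×-congˡ (ℕ.m≡m%n+[m/n]*n k r) ⟩
    (k ℕ.% r ℕ.+ (k ℕ./ r) ℕ.* r) · x        ≈⟨ ×-homo-+ x (k ℕ.% r) _ ⟩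
    (k ℕ.% r) · x ∙ ((k ℕ./ r) ℕ.* r) · x    ≈⟨ ∙-congˡ (×-congˡ (ℕ.*-comm (k ℕ./ r) r)) ⟩
    (k ℕ.% r) · x ∙ (r ℕ.* (k ℕ./ r)) · x    ≈⟨ ∙-congˡ (sym (×-assocˡ x r (k ℕ./ r))) ⟩
    (k ℕ.% r) · x ∙ r · ((k ℕ./ r) · x)      ∎

  module _ (ω : Carrier) (cover : ∀ u → ∃ λ k → ∃ λ y → u ≈ k · ω ∙ f · y) where

    -- If r · ω ∈ S then the classes of 0 · ω, …, (r − 1) · ω exhaust the f
    -- cosets of S.
    no-small : ∀ r .{{_ : NonZero r}} → r < f → ¬ Member (r · ω)
    no-small r r<f rω∈S = ℕ.<⇒≱ r<f (Fin.injective⇒≤ {f = residue} residue-inj)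
      where
      k : Fin f → ℕ
      k j = proj₁ (cover (B.to j))
      residue : Fin f → Fin r
      residue j = fromℕ< (ℕ.m%n<n (k j) r)
      ~residue : ∀ j → (toℕ (residue j) · ω) C.≈ B.to j
      ~residue j = ≡.subst (λ n → (n · ω) C.≈ B.to j) (≡.sym (Fin.toℕ-fromℕ< (ℕ.m%n<n (k j) r)))
        (C.trans {(k j ℕ.% r) · ω} {k j · ω} {B.to j}
          (C.trans {(k j ℕ.% r) · ω} {(k j ℕ.% r) · ω ∙ r · ((k j ℕ./ r) · ω)} {k j · ω}
            (C-∙ (resp (swap (k j ℕ./ r)) (·-closed (k j ℕ./ r) rω∈S)))
            (≈⇒C (sym (divMod· (k j) r ω))))
          (C.trans {k j · ω} {k j · ω ∙ f · proj₁ (proj₂ (cover (B.to j)))} {B.to j}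
            (C-∙ (index-kills _))
            (≈⇒C (sym (proj₂ (proj₂ (cover (B.to j))))))))
        where
        swap : ∀ n → n · (r · ω) ≈ r · (n · ω)
        swap n = trans (×-assocˡ ω n r) (trans (×-congˡ (ℕ.*-comm n r)) (sym (×-assocˡ ω r n)))
      residue-inj : ∀ {j j′} → residue j ≡ residue j′ → j ≡ j′
      residue-inj {j} {j′} eq = B.injective {j} {j′} (C.trans {B.to j} {toℕ (residue j) · ω} {B.to j′}
        (C.sym {toℕ (residue j) · ω} {B.to j} (~residue j))
        (≡.subst (λ n → (toℕ n · ω) C.≈ B.to j′) (≡.sym eq) (~residue j′)))

    ∈⇒divisible : ∀ x → Member x → ∃ λ y → f · y ≈ x
    ∈⇒divisible x x∈S = helper (k ℕ.% f) ≡.refl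
      where
      instance _ = f≢0
      k = proj₁ (cover x)
      y = proj₁ (proj₂ (cover x))
      z = (k ℕ./ f) · ω ∙ y
      x≈ : x ≈ (k ℕ.% f) · ω ∙ f · z
      x≈ = begin
        x                                                  ≈⟨ proj₂ (proj₂ (cover x)) ⟩
        k · ω ∙ f · y                                      ≈⟨ ∙-congʳ (divMod· k f ω) ⟩
        ((k ℕ.% f) · ω ∙ f · ((k ℕ./ f) · ω)) ∙ f · y      ≈⟨ assoc _ _ _ ⟩
        (k ℕ.% f) · ω ∙ (f · ((k ℕ./ f) · ω) ∙ f · y)      ≈⟨ ∙-congˡ (sym (×-distrib-+ _ y f)) ⟩
        (k ℕ.% f) · ω ∙ f · z                              ∎
      rω∈S : Member ((k ℕ.% f) · ω)
      rω∈S = C⇒∈ (C.trans {ε} {x} {(k ℕ.% f) · ω} (∈⇒C x∈S)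
        (C.trans {x} {(k ℕ.% f) · ω ∙ f · z} {(k ℕ.% f) · ω} (≈⇒C x≈)
          (C.sym {(k ℕ.% f) · ω} {(k ℕ.% f) · ω ∙ f · z} (C-∙ (index-kills z)))))
      helper : ∀ r → k ℕ.% f ≡ r → ∃ λ y → f · y ≈ x
      helper zero    eq = z , sym (trans x≈ (trans (∙-congʳ (×-congˡ eq)) (identityˡ _)))
      helper (suc r) eq = contradiction (≡.subst (λ n → Member (n · ω)) eq rω∈S)
        (no-small (suc r) (≡.subst (_< f) eq (ℕ.m%n<n k f)))

module Ẑ {p : Level} (P : Pred ℕ p) (P-prime : ∀ {q} → P q → Prime q) (o : Level) where
  module Z = TopologicalGroup (ℤ⟨ P ⟩ o)

  coord : Z.Carrier → Refinement ℕ P → ℕ → ℤ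
  coord z q = proj₁ (z q)

  isPrime : (q : Refinement ℕ P) → Prime (value q)
  isPrime (q , [ q∈P ]) = recompute (prime? q) (P-prime q∈P)

  coord-· : ∀ n z q k → coord (n Z.· z) q k ≡ + n ℤ.* coord z q k
  coord-· zero    z q k = ≡.sym (ℤ.*-zeroˡ (coord z q k))
  coord-· (suc n) z q k = ≡.trans (≡.cong (λ w → coord z q k ℤ.+ w) (coord-· n z q k)) (≡.sym (ℤ.suc-* (+ n) (coord z q k)))

  module _ (f : ℕ) .{{_ : NonZero f}} where
    factorᵢ : (q : Refinement ℕ P) → _
    factorᵢ q = factor (value q) (isPrime q) f

    val : Refinement ℕ P → ℕ
    val q = proj₁ (factorᵢ q)

    Vanishes : Pred Z.Carrier p
    Vanishes z = ∀ q → + (value q ^ val q) ℤ.∣ coord z q (val q)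

    vanishes⇒divisible : ∀ z → Vanishes z → ∃ λ y → f Z.· y Z.≈ z
    vanishes⇒divisible z z≡0 = (λ q → proj₁ (div q) , proj₁ (proj₂ (div q))) , eq
      where
      div : ∀ q → _
      div q = p-adic-divide (value q) (isPrime q) (val q) (proj₁ (proj₂ (factorᵢ q)))
                (proj₂ (proj₂ (proj₂ (factorᵢ q)))) (coord z q) (proj₂ (z q)) (z≡0 q)
      eq : ∀ q k → + (value q ^ k) ℤ.∣ ℤ.- coord (f Z.· (λ q → proj₁ (div q) , proj₁ (proj₂ (div q)))) q k ℤ.+ coord z q k
      eq q k = ≡.subst (λ w → + (value q ^ k) ℤ.∣ ℤ.- w ℤ.+ coord z q k)
        (≡.sym (≡.trans (coord-· f _ q k) (≡.cong (λ n → + n ℤ.* proj₁ (div q) k) (proj₁ (proj₂ (proj₂ (factorᵢ q)))))))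
        (proj₂ (proj₂ (div q)) k)

    divisible⇒vanishes : ∀ z y → f Z.· y Z.≈ z → Vanishes z
    divisible⇒vanishes z y fy≈z q = ≡.subst (Q ℤ.∣_) (lemma (coord (f Z.· y) q v) (coord z q v))
      (ℤ.∣m∣n⇒∣m+n (fy≈z q v)
        (≡.subst (Q ℤ.∣_) (≡.sym (coord-· f y q v)) (ℤ.∣m⇒∣m*n (coord y q v) Q∣f)))
      where
      v = val q
      Q = + (value q ^ v)
      Q∣f : Q ℤ.∣ + f
      Q∣f = ∣ᵤ⇒∣ (≡.subst (value q ^ v ℕ.∣_) (≡.sym (proj₁ (proj₂ (proj₂ (factorᵢ q))))) (ℕ.m∣m*n _))
      lemma : ∀ a b → (ℤ.- a ℤ.+ b) ℤ.+ a ≡ b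
      lemma = solve-∀

    -- val q = 0 unless q ∣ f
    val≢0⇒≤ : ∀ q → (val q ≡ 0) ⊎ (value q < suc f)
    val≢0⇒≤ q with val q | proj₁ (proj₂ (factorᵢ q)) | proj₁ (proj₂ (proj₂ (factorᵢ q)))
    ... | zero  | _ | _  = inj₁ ≡.refl
    ... | suc v | m | eq = inj₂ (ℕ.s≤s (ℕ.∣⇒≤ (≡.subst (value q ℕ.∣_) (≡.sym eq)
                             (ℕ.∣-trans (ℕ.m∣m*n (value q ^ v)) (ℕ.m∣m*n m)))))

    primesBelow : ∀ n → (∀ q → q < n → Dec (P q)) →
                  Σ[ F ∈ List (Refinement ℕ P) ] (∀ q → value q < n → q ∈ F)
    primesBelow zero    dec = [] , λ _ ()
    primesBelow (suc n) dec with primesBelow n (λ q q<n → dec q (ℕ.m<n⇒m<1+n q<n)) | dec n (ℕ.n<1+n n)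
    ... | F , F-all | yes n∈P = (n , [ n∈P ]) ∷ F , all
      where
      all : ∀ q → value q < suc n → q ∈ (n , [ n∈P ]) ∷ F
      all q q<1+n with ℕ.m≤n⇒m<n∨m≡n (ℕ.s≤s⁻¹ q<1+n)
      ... | inj₁ q<n    = there (F-all q q<n)
      ... | inj₂ ≡.refl = here ≡.refl
    ... | F , F-all | no  n∉P = F , all
      where
      all : ∀ q → value q < suc n → q ∈ F
      all q@(_ , [ q∈P ]) q<1+n with ℕ.m≤n⇒m<n∨m≡n (ℕ.s≤s⁻¹ q<1+n)
      ... | inj₁ q<n    = F-all q q<n
      ... | inj₂ ≡.refl = ⊥-elim-irr (n∉P q∈P)

    Near : Z.Carrier → List (Refinement ℕ P) → Box (λ q → ℤ[ value q ] o)
    Near x []      = []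
    Near x (q ∷ F) =
      ( q , (λ z → Lift o (_≈ₖ_ (coord x q (val q)) (proj₁ z (val q))))
      , ( (λ z → Lift o (_≈ₖ_ (coord x q (val q)) (z (val q))))
        , (λ z z∈ → (val q , (λ w → Lift o (_≈ₖ_ (coord x q (val q)) w)) , lift (λ {a} {b} a≈b (lift xa) → lift (Zq.trans {coord x q (val q)} {a} {b} xa a≈b))) ∷ []
                    , (z∈ , tt) , proj₁)
        , id , id ) ) ∷ Near x F
      where
      module Zq = Group (ℤ/ (value q ^ val q))
      open Zq using () renaming (_≈_ to _≈ₖ_)

    near-refl : ∀ x F → ⟦_⟧ (λ q → ℤ[ value q ] o) (Near x F) x
    near-refl x []      = tt
    near-refl x (q ∷ F) = lift (Group.refl (ℤ/ (value q ^ val q)) {coord x q (val q)}) , near-refl x F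

    near⇒ : ∀ x F z → ⟦_⟧ (λ q → ℤ[ value q ] o) (Near x F) z →
            ∀ {q} → q ∈ F → + (value q ^ val q) ℤ.∣ ℤ.- coord x q (val q) ℤ.+ coord z q (val q)
    near⇒ x (q ∷ F) z (lift e , _) (here ≡.refl) = e
    near⇒ x (_ ∷ F) z (_ , z∈)     (there q∈F)   = near⇒ x F z z∈ q∈F

    near⇒vanishes : ∀ x F z → (∀ q → value q < suc f → q ∈ F) →
                    ⟦_⟧ (λ q → ℤ[ value q ] o) (Near x F) z → Vanishes (x Z.⁻¹ Z.∙ z)
    near⇒vanishes x F z F-all z∈ q = case (val≢0⇒≤ q)
      where
      w : ℤ
      w = ℤ.- coord x q (val q) ℤ.+ coord z q (val q)
      case : (val q ≡ 0) ⊎ (value q < suc f) → + (value q ^ val q) ℤ.∣ w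
      case (inj₂ q≤f) = near⇒ x F z z∈ (F-all q q≤f)
      case (inj₁ v≡0) = ≡.subst (λ v → + (value q ^ v) ℤ.∣ w) (≡.sym v≡0)
                          (divides w (≡.sym (ℤ.*-identityʳ w)))

  ≈-trans : ∀ x y z → x Z.≈ y → y Z.≈ z → x Z.≈ z
  ≈-trans x y z = Z.trans {x} {y} {z}

  ≈-sym : ∀ x y → x Z.≈ y → y Z.≈ x
  ≈-sym x y = Z.sym {x} {y}

  Z-comm : ∀ x y → x Z.∙ y Z.≈ y Z.∙ x
  Z-comm x y q k = divides (+ 0) (lemma (coord x q k) (coord y q k) (+ (value q ^ k)))
    where
    lemma : ∀ a b Q → ℤ.- (a ℤ.+ b) ℤ.+ (b ℤ.+ a) ≡ + 0 ℤ.* Q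
    lemma = solve-∀

¬¬-dec-below : {P : Pred ℕ p} → ∀ n → ¬ ¬ (∀ q → q < n → Dec (P q))
¬¬-dec-below zero    k = k (λ _ ())
¬¬-dec-below {P = P} (suc n) k = ¬¬-dec-below {P = P} n λ dec → ¬¬-excluded-middle {A = P n} λ n? →
  k (λ q q<1+n → extend dec n? q (ℕ.m≤n⇒m<n∨m≡n (ℕ.s≤s⁻¹ q<1+n)))
  where
  extend : (∀ q → q < n → Dec (P q)) → Dec (P n) → ∀ q → (q < n) ⊎ (q ≡ n) → Dec (P q)
  extend dec n? q (inj₁ q<n)    = dec q q<n
  extend dec n? q (inj₂ ≡.refl) = n?

module IndexedSubgroup
  {p c ℓ o s : Level} (P : Pred ℕ p) (P-prime : ∀ {q} → P q → Prime q)
  (Ω : TopologicalGroup c ℓ o) (Ω≅ : Ω ≅ ℤ⟨ P ⟩ o)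
  (ω : TopologicalGroup.Carrier Ω) (ω-gen : TopologicalGroup.IsTopologicalGenerator Ω ω)
  (S : Subgroup (TopologicalGroup.group Ω) s)
  (f : ℕ) (card : HasIndex (TopologicalGroup.group Ω) S f) where
  open TopologicalGroup Ω
  open _≅_ Ω≅
  open Ẑ P P-prime o
  module To = ContinuousHom iso
  module From = ContinuousHom iso⁻¹
  open SetoidReasoning setoid

  Ω-comm : ∀ x y → x ∙ y ≈ y ∙ x
  Ω-comm x y = begin
    x ∙ y                ≈⟨ sym (from∘to _) ⟩
    from (to (x ∙ y))    ≈⟨ From.⟦⟧-cong {to (x ∙ y)} {to (y ∙ x)} to-comm ⟩
    from (to (y ∙ x))    ≈⟨ from∘to _ ⟩
    y ∙ x                ∎
    where
    to-comm : to (x ∙ y) Z.≈ to (y ∙ x)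
    to-comm = ≈-trans (to (x ∙ y)) (to x Z.∙ to y) (to (y ∙ x)) (To.homo x y)
      (≈-trans (to x Z.∙ to y) (to y Z.∙ to x) (to (y ∙ x)) (Z-comm (to x) (to y))
        (≈-sym (to (y ∙ x)) (to y Z.∙ to x) (To.homo y x)))

  abelian : AbelianGroup c ℓ
  abelian = record { isAbelianGroup = record { isGroup = isGroup ; comm = Ω-comm } }

  open IndexDivision abelian S f card
  open Mult (AbelianGroup.commutativeMonoid abelian) hiding (_×_)
  open AbelianGroupProperties abelian using (xyx⁻¹≈y)
  open GroupProperties group using (⁻¹-involutive)

  instance _ = f≢0

  from-· : ∀ n z → from (n Z.· z) ≈ n · from z
  from-· zero    z = From.ε-homo
  from-· (suc n) z = trans (From.homo z (n Z.· z)) (∙-congˡ (from-· n z))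

  to-· : ∀ n x → to (n · x) Z.≈ n Z.· to x
  to-· zero    x = To.ε-homo
  to-· (suc n) x = ≈-trans (to (suc n · x)) (to x Z.∙ to (n · x)) (suc n Z.· to x)
    (To.homo x (n · x)) (Z.∙-congˡ {to x} {to (n · x)} {n Z.· to x} (to-· n x))

  pull : ∀ x → (∃ λ y → f Z.· y Z.≈ to x) → ∃ λ y → f · y ≈ x
  pull x (y , eq) = from y , trans (sym (from-· f y)) (trans (From.⟦⟧-cong {f Z.· y} {to x} eq) (from∘to x))

  -- −(n · ω) differs from ((f − 1) n) · ω by a multiple of f.
  negative : ∀ n → ∃ λ k → ∃ λ y → (n · ω) ⁻¹ ≈ k · ω ∙ f · y
  negative n = ℕ.pred f ℕ.* n , (n · ω) ⁻¹ , sym (begin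
    (ℕ.pred f ℕ.* n) · ω ∙ f · w            ≈⟨ ∙-cong (sym (×-assocˡ ω (ℕ.pred f) n)) (×-congˡ (≡.sym (ℕ.suc-pred f))) ⟩
    ℕ.pred f · (n · ω) ∙ (w ∙ ℕ.pred f · w) ≈⟨ ∙-congˡ (Ω-comm w _) ⟩
    ℕ.pred f · (n · ω) ∙ (ℕ.pred f · w ∙ w) ≈⟨ sym (assoc _ _ w) ⟩
    (ℕ.pred f · (n · ω) ∙ ℕ.pred f · w) ∙ w ≈⟨ ∙-congʳ (sym (×-distrib-+ (n · ω) w (ℕ.pred f))) ⟩
    ℕ.pred f · (n · ω ∙ w) ∙ w              ≈⟨ ∙-congʳ (×-congʳ (ℕ.pred f) (inverseʳ _)) ⟩
    ℕ.pred f · ε ∙ w                        ≈⟨ ∙-congʳ (·-ε (ℕ.pred f)) ⟩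
    ε ∙ w                                   ≈⟨ identityˡ w ⟩
    w                                       ∎)
    where
    w = (n · ω) ⁻¹
    ·-ε : ∀ m → m · ε ≈ ε
    ·-ε zero    = refl
    ·-ε (suc m) = trans (identityˡ _) (·-ε m)

  cover : (∀ q → q < suc f → Dec (P q)) → ∀ u → ∃ λ k → ∃ λ y → u ≈ k · ω ∙ f · y
  cover dec u = finish (proj₂ (proj₂ hit))
    where
    F = primesBelow f (suc f) dec
    box = Near f (to u) (proj₁ F)
    hit = ω-gen (λ x → ⟦_⟧ (λ q → ℤ[ value q ] o) box (to x))
            (To.continuous (λ z z∈ → box , z∈ , id)) u (near-refl f (to u) (proj₁ F))
    x = proj₁ hit
    div : ∃ λ y → f · y ≈ u ⁻¹ ∙ x
    div = pull (u ⁻¹ ∙ x)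
      ( proj₁ q , ≈-trans (f Z.· proj₁ q) (to u Z.⁻¹ Z.∙ to x) (to (u ⁻¹ ∙ x)) (proj₂ q)
          (≈-sym (to (u ⁻¹ ∙ x)) (to u Z.⁻¹ Z.∙ to x)
            (≈-trans (to (u ⁻¹ ∙ x)) (to (u ⁻¹) Z.∙ to x) (to u Z.⁻¹ Z.∙ to x) (To.homo (u ⁻¹) x)
              (Z.∙-congʳ {to x} {to (u ⁻¹)} {to u Z.⁻¹} (To.⁻¹-homo u)))))
      where
      q = vanishes⇒divisible f (to u Z.⁻¹ Z.∙ to x)
            (near⇒vanishes f (to u) (proj₁ F) (to x) (proj₂ F) (proj₁ (proj₂ hit)))
    y = proj₁ div
    u≈ : u ≈ x ∙ f · (y ⁻¹)
    u≈ = begin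
      u                              ≈⟨ sym (identityʳ u) ⟩
      u ∙ ε                          ≈⟨ ∙-congˡ (sym (·-ε f)) ⟩
      u ∙ f · ε                      ≈⟨ ∙-congˡ (×-congʳ f (sym (inverseʳ y))) ⟩
      u ∙ f · (y ∙ y ⁻¹)             ≈⟨ ∙-congˡ (×-distrib-+ y (y ⁻¹) f) ⟩
      u ∙ (f · y ∙ f · (y ⁻¹))       ≈⟨ ∙-congˡ (∙-congʳ (proj₂ div)) ⟩
      u ∙ ((u ⁻¹ ∙ x) ∙ f · (y ⁻¹))  ≈⟨ sym (assoc u _ _) ⟩
      (u ∙ (u ⁻¹ ∙ x)) ∙ f · (y ⁻¹)  ≈⟨ ∙-congʳ (sym (assoc u _ x)) ⟩
      ((u ∙ u ⁻¹) ∙ x) ∙ f · (y ⁻¹)  ≈⟨ ∙-congʳ (trans (∙-congʳ (inverseʳ u)) (identityˡ x)) ⟩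
      x ∙ f · (y ⁻¹)                 ∎
      where
      ·-ε : ∀ m → m · ε ≈ ε
      ·-ε zero    = refl
      ·-ε (suc m) = trans (identityˡ _) (·-ε m)
    finish : (∃ λ n → (x ≈ n · ω) ⊎ (x ≈ (n · ω) ⁻¹)) → ∃ λ k → ∃ λ y → u ≈ k · ω ∙ f · y
    finish (n , inj₁ x≈) = n , y ⁻¹ , trans u≈ (∙-congʳ x≈)
    finish (n , inj₂ x≈) =
      let (k , y′ , eq) = negative n
      in k , y′ ∙ y ⁻¹ , trans u≈ (trans (∙-congʳ (trans x≈ eq))
           (trans (assoc _ _ _) (∙-congˡ (sym (×-distrib-+ y′ (y ⁻¹) f)))))

  abstract
   -- S ⊆ fΩ.  Divisibility by f can be tested on residues, which is
   -- decidable, so decidability of P may be used although P is arbitrary.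
   ∈⇒f∣ : ∀ x → Subgroup.Member S x → ∃ λ y → f · y ≈ x
   ∈⇒f∣ x x∈S = pull x (vanishes⇒divisible f (to x) λ q →
     decidable-stable (+ (value q ^ val f q) ℤ.∣? coord (to x) q (val f q)) λ ¬d →
       ¬¬-dec-below {P = P} (suc f) λ dec →
         let (y , eq) = ∈⇒divisible ω (cover dec) x x∈S
         in ¬d (divisible⇒vanishes f (to x) (to y) 
                  (≈-trans (f Z.· to y) (to (f · y)) (to x)
                    (≈-sym (to (f · y)) (f Z.· to y) (to-· f y)) (To.⟦⟧-cong {f · y} {x} eq)) q))

-- f_H = [Ω : d(H)] is the field degree.
record IsInertiallyFinite {G : TopologicalGroup c ℓ o} {Ω : TopologicalGroup c′ ℓ′ o}
         (d : ContinuousHom G Ω) (H : Subgroup (TopologicalGroup.group G) o) :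
         Set (c ⊔ ℓ ⊔ c′ ⊔ ℓ′ ⊔ lsuc o) where
  field
    closed   : TopologicalGroup.IsClosed G (Subgroup.Member H)
    degree   : ℕ
    hasIndex : HasIndex (TopologicalGroup.group Ω) (image d H) degree

module Frobenius
  {p c ℓ c′ ℓ′ o : Level} (P : Pred ℕ p) (P-prime : ∀ {q} → P q → Prime q)
  {G : TopologicalGroup c ℓ o} {Ω : TopologicalGroup c′ ℓ′ o} (Ω≅ℤP : Ω ≅ ℤ⟨ P ⟩ o)
  (ω : TopologicalGroup.Carrier Ω) (ω-generates : TopologicalGroup.IsTopologicalGenerator Ω ω)
  (d : ContinuousHom G Ω)
  (H : Subgroup (TopologicalGroup.group G) o) (H-finite : IsInertiallyFinite d H)
  where
  open IsInertiallyFinite H-finite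
  private
    module Ω = TopologicalGroup Ω
    module HΩ = IndexedSubgroup P P-prime Ω Ω≅ℤP ω ω-generates (image d H) degree hasIndex

  Hᵗ : TopologicalGroup (c ⊔ o) ℓ o
  Hᵗ = subgroupᵗ G H

  private
    module Hᵗ = TopologicalGroup Hᵗ

    divided : ∀ h → ∃ λ y → degree Ω.· y Ω.≈ ContinuousHom.to d (proj₁ h)
    divided (g , g∈H) = HΩ.∈⇒f∣ (ContinuousHom.to d g) (g , g∈H , Ω.refl)

  dH : Hᵗ.Carrier → Ω.Carrier
  dH h = proj₁ (divided h)

  -- Since Ω is torsion-free, this determines dH = (1 / f_H) d.
  dH-spec : ∀ h → degree Ω.· dH h Ω.≈ ContinuousHom.to d (proj₁ h)
  dH-spec h = proj₂ (divided h)

  Frob : Pred Hᵗ.Carrier ℓ′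
  Frob h = Ω.PositiveMultiple ω (dH h)

record IsSubsemigroup (S : Semigroup c ℓ) (A : Pred (Semigroup.Carrier S) a) : Set (c ⊔ ℓ ⊔ a) where
  open Semigroup S
  field
    resp     : A Respects _≈_
    ∙-closed : ∀ {x y} → A x → A y → A (x ∙ y)

  subsemigroup : Semigroup (c ⊔ a) ℓ
  subsemigroup = record
    { Carrier = Σ Carrier A
    ; _≈_     = λ x y → proj₁ x ≈ proj₁ y
    ; _∙_     = λ x y → proj₁ x ∙ proj₁ y , ∙-closed (proj₂ x) (proj₂ y)
    ; isSemigroup = record
      { isMagma = record
        { isEquivalence = record { refl = refl ; sym = sym ; trans = trans }
        ; ∙-cong = ∙-cong }
      ; assoc = λ x y z → assoc (proj₁ x) (proj₁ y) (proj₁ z) }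
    }

{-# OPTIONS --safe #-}
module Submission where

-- Let U be the kernel of the projection of G onto a member of order m of the
-- inverse system; the cosets of such U form a basis of the topology.  By
-- Lagrange's theorem h ^ m ∈ U for all h ∈ H, and d_H is onto, so d_H (U ∩ H)
-- contains mΩ.  All prime divisors of m lie in P, so agreement modulo m is an
-- open condition on Ω ≅ ℤ_P; as ω is a topological generator, every class
-- of Ω / mΩ is represented by an integer multiple of ω, hence by a positive
-- one.  So every coset g (U ∩ H) contains an element of Frob_H.

open import Algebra.Bundles using (AbelianGroup; CommutativeMonoid; Group; Semigroup)
import Algebra.Definitions.RawMonoid as RawMonoidDefinitions
open import Algebra.Morphism.Structures using (module GroupMorphisms; module MagmaMorphisms)
import Algebra.Properties.CommutativeMonoid.Mult as CommutativeMult
import Algebra.Properties.CommutativeMonoid.Sum as Sum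
import Algebra.Properties.Group as GroupProperties
import Algebra.Properties.Monoid.Mult as Mult
open import Data.Fin.Base using (Fin; toℕ)
open import Data.Fin.Permutation using (Permutation; permutation; _⟨$⟩ʳ_)
import Data.Fin.Properties as Fin
open import Data.Integer.Base as ℤ using (ℤ; +_)
import Data.Integer.Coprimality as ℤ
open import Data.Integer.Divisibility.Signed as ℤ using (∣ᵤ⇒∣; ∣⇒∣ᵤ)
import Data.Integer.Properties as ℤ
open import Data.Integer.Tactic.RingSolver using (solve-∀)
open import Data.Irrelevant using ([_])
open import Data.List.Base using (List; []; _∷_)
open import Data.List.Membership.Propositional using (_∈_)
open import Data.List.Relation.Unary.Any using (here; there)
open import Data.Nat.Base as ℕ using (ℕ; zero; suc; _≤_; _<_; _^_; NonZero)
open import Data.Nat.DivMod using (_%_; _/_; m%n<n; m≡m%n+[m/n]*n)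
open import Data.Nat.Divisibility as ℕ using ()
open import Data.Nat.Primality using (Prime; prime?; prime⇒nonZero)
import Data.Nat.Properties as ℕ
open import Data.Product.Base using (Σ-syntax; ∃; _×_; _,_; proj₁; proj₂)
open import Data.Refinement using (Refinement; _,_; value)
open import Data.Sum.Base using (_⊎_; inj₁; inj₂)
open import Data.Unit.Polymorphic.Base using (tt)
open import Function.Base using (_∘_; id)
open import Function.Bundles using (module Bijection)
open import Function.Definitions using (Surjective)
open import Level using (Level; lift)
open import Relation.Binary.PropositionalEquality as ≡ using (_≡_)
import Relation.Binary.Reasoning.Setoid as SetoidReasoning
open import Relation.Nullary using (¬_; yes; no; contradiction)
open import Relation.Nullary.Decidable using (_×-dec_)
open import Relation.Unary using (Pred)
open import Defs

private
  variable
    p c c′ ℓ ℓ′ o s i : Level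

-- Lagrange's theorem: the order of a finite group annihilates every element.

argmin : (v : ℕ → ℕ) → ∀ n → ∃ λ k → ∀ j → j < suc n → v k ≤ v j
argmin v zero    = 0 , λ { zero _ → ℕ.≤-refl ; (suc _) (ℕ.s≤s ()) }
argmin v (suc n) with k , k-min ← argmin v n | ℕ.≤-total (v k) (v (suc n))
... | inj₁ vk≤ = k , λ j j≤1+n → below j (ℕ.m≤n⇒m<n∨m≡n (ℕ.s≤s⁻¹ j≤1+n))
  where
  below : ∀ j → _ → v k ≤ v j
  below j (inj₁ j≤n)    = k-min j j≤n
  below j (inj₂ ≡.refl) = vk≤
... | inj₂ ≤vk = suc n , λ j j≤1+n → below j (ℕ.m≤n⇒m<n∨m≡n (ℕ.s≤s⁻¹ j≤1+n))
  where
  below : ∀ j → _ → v (suc n) ≤ v j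
  below j (inj₁ j≤n)    = ℕ.≤-trans ≤vk (k-min j j≤n)
  below j (inj₂ ≡.refl) = ℕ.≤-refl

-- Pick in every orbit of left translation by x the element r of least index,
-- and for every g an exponent k g with x ^ k g ∙ g ≈ r.  Then
-- x ^ (1 + k (x ∙ g)) ≈ x ^ k g, and multiplying this over all g in the
-- group leaves x ^ n ≈ ε.
module Lagrange (A : Group c ℓ) {n : ℕ} (card : HasCardinality (Group.setoid A) n)
                (x : Group.Carrier A) where
  open Group A
  open GroupProperties A
  open Mult monoid renaming (_×_ to _·_)
  open SetoidReasoning setoid
  private module B = Bijection card

  index : Carrier → Fin n
  index g = proj₁ (B.surjective g)

  to-index : ∀ g → B.to (index g) ≈ g
  to-index g = proj₂ (B.surjective g) ≡.refl

  index-cong : ∀ {g h} → g ≈ h → index g ≡ index h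
  index-cong g≈h = B.injective (trans (to-index _) (trans g≈h (sym (to-index _))))

  index-injective : ∀ {g h} → index g ≡ index h → g ≈ h
  index-injective {g} {h} eq =
    trans (sym (to-index g)) (trans (reflexive (≡.cong B.to eq)) (to-index h))

  index-to : ∀ j → index (B.to j) ≡ j
  index-to j = B.injective (to-index (B.to j))

  -- By pigeonhole two of the `n + 1` multiples `0 · x`, ..., `n · x` coincide, and their difference
  -- is a period. The form `suc k` keeps it nonzero, so that it can serve as a modulus.
  period : ∃ λ k → suc k · x ≈ ε
  period with i , j , i<j , eq ← Fin.pigeonhole (ℕ.n<1+n n) (λ i → index (toℕ i · x))
    with k , 1+i+k≡j ← ℕ.m≤n⇒∃[o]m+o≡n i<j =
    k , identityʳ-unique (toℕ i · x) (suc k · x) (begin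
      toℕ i · x ∙ suc k · x  ≈⟨ ×-homo-+ x (toℕ i) (suc k) ⟨
      (toℕ i ℕ.+ suc k) · x  ≈⟨ ×-congˡ (≡.trans (ℕ.+-suc (toℕ i) k) 1+i+k≡j) ⟩
      toℕ j · x              ≈⟨ index-injective eq ⟨
      toℕ i · x              ∎)

  private
    N = proj₁ period

  ·-ε : ∀ k → k · ε ≈ ε
  ·-ε zero    = refl
  ·-ε (suc k) = trans (identityˡ _) (·-ε k)

  ·-%-period : ∀ k → k · x ≈ (k % suc N) · x
  ·-%-period k = begin
    k · x                                          ≈⟨ ×-congˡ (m≡m%n+[m/n]*n k (suc N)) ⟩
    (k % suc N ℕ.+ (k / suc N) ℕ.* suc N) · x      ≈⟨ ×-homo-+ x (k % suc N) _ ⟩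
    (k % suc N) · x ∙ ((k / suc N) ℕ.* suc N) · x  ≈⟨ ∙-congˡ (×-assocˡ x (k / suc N) (suc N)) ⟨
    (k % suc N) · x ∙ (k / suc N) · (suc N · x)    ≈⟨ ∙-congˡ (×-congʳ (k / suc N) (proj₂ period)) ⟩
    (k % suc N) · x ∙ (k / suc N) · ε              ≈⟨ ∙-congˡ (·-ε (k / suc N)) ⟩
    (k % suc N) · x ∙ ε                            ≈⟨ identityʳ _ ⟩
    (k % suc N) · x                                ∎

  rank : Carrier → ℕ → ℕ
  rank g k = toℕ (index (k · x ∙ g))

  exponent : Carrier → ℕ
  exponent g = proj₁ (argmin (rank g) N)

  -- The search only covers the exponents `0`, ..., `N`, but these are all residues modulo the
  -- period `suc N`.
  exponent-min : ∀ g k → rank g (exponent g) ≤ rank g k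
  exponent-min g k = ℕ.≤-trans (proj₂ (argmin (rank g) N) (k % suc N) (m%n<n k (suc N)))
    (ℕ.≤-reflexive (≡.cong toℕ (index-cong (∙-congʳ (sym (·-%-period k))))))

  shift : ∀ {g g′} k → g′ ≈ x ∙ g → k · x ∙ g′ ≈ suc k · x ∙ g
  shift {g} {g′} k g′≈xg = begin
    k · x ∙ g′           ≈⟨ ∙-congˡ g′≈xg ⟩
    k · x ∙ (x ∙ g)      ≈⟨ assoc _ x g ⟨
    (k · x ∙ x) ∙ g      ≈⟨ ∙-congʳ (∙-congˡ (×-homo-1 x)) ⟨
    (k · x ∙ 1 · x) ∙ g  ≈⟨ ∙-congʳ (×-homo-+ x k 1) ⟨
    (k ℕ.+ 1) · x ∙ g    ≈⟨ ∙-congʳ (×-congˡ (ℕ.+-comm k 1)) ⟩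
    suc k · x ∙ g        ∎

  -- The orbits of `g` and `x ∙ g` coincide, so both minima are attained at the same element;
  -- cancelling `g` compares the exponents.
  exponent-shift : ∀ {g g′} → g′ ≈ x ∙ g → suc (exponent g′) · x ≈ exponent g · x
  exponent-shift {g} {g′} g′≈xg = ∙-cancelʳ g _ _ (trans (sym (shift e′ g′≈xg))
    (index-injective (Fin.toℕ-injective (ℕ.≤-antisym lower upper))))
    where
    e  = exponent g
    e′ = exponent g′
    -- Reaching `e · x ∙ g` from `x ∙ g` takes `e - 1` translations, which would be negative for
    -- `e = 0`; adding the period `suc N` gives `e + N`.
    around : (e ℕ.+ N) · x ∙ g′ ≈ e · x ∙ g
    around = begin
      (e ℕ.+ N) · x ∙ g′       ≈⟨ shift (e ℕ.+ N) g′≈xg ⟩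
      suc (e ℕ.+ N) · x ∙ g    ≈⟨ ∙-congʳ (×-congˡ (ℕ.+-suc e N)) ⟨
      (e ℕ.+ suc N) · x ∙ g    ≈⟨ ∙-congʳ (×-homo-+ x e (suc N)) ⟩
      (e · x ∙ suc N · x) ∙ g  ≈⟨ ∙-congʳ (∙-congˡ (proj₂ period)) ⟩
      (e · x ∙ ε) ∙ g          ≈⟨ ∙-congʳ (identityʳ _) ⟩
      e · x ∙ g                ∎
    lower : rank g′ e′ ≤ rank g e
    lower = ℕ.≤-trans (exponent-min g′ (e ℕ.+ N)) (ℕ.≤-reflexive (≡.cong toℕ (index-cong around)))
    upper : rank g e ≤ rank g′ e′
    upper = ℕ.≤-trans (exponent-min g (suc e′))
      (ℕ.≤-reflexive (≡.cong toℕ (index-cong (sym (shift e′ g′≈xg)))))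

  -- The powers of `x`, represented by their exponents. `A` may be noncommutative, whereas
  -- reindexing a finite sum requires commutativity.
  exponents : CommutativeMonoid _ _
  exponents = record
    { Carrier = ℕ
    ; _≈_     = λ j k → j · x ≈ k · x
    ; _∙_     = ℕ._+_
    ; ε       = 0
    ; isCommutativeMonoid = record
      { isMonoid = record
        { isSemigroup = record
          { isMagma = record
            { isEquivalence = record { refl = refl ; sym = sym ; trans = trans }
            ; ∙-cong = λ {j} {j′} {k} {k′} j~j′ k~k′ →
                trans (×-homo-+ x j k) (trans (∙-cong j~j′ k~k′) (sym (×-homo-+ x j′ k′))) }
          ; assoc = λ i j k → ×-congˡ (ℕ.+-assoc i j k) }
        ; identity = (λ k → refl) , (λ k → ×-congˡ (ℕ.+-identityʳ k)) }
      ; comm = λ j k → ×-congˡ (ℕ.+-comm j k) }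
    }

  translation : Permutation n n
  translation = permutation (translate x) (translate (x ⁻¹))
    (there-back x (x ⁻¹) (inverseʳ x)) (there-back (x ⁻¹) x (inverseˡ x))
    where
    translate : Carrier → Fin n → Fin n
    translate y j = index (y ∙ B.to j)
    there-back : ∀ y z → y ∙ z ≈ ε → ∀ j → translate y (translate z j) ≡ j
    there-back y z yz≈ε j = ≡.trans (index-cong (begin
      y ∙ B.to (index (z ∙ B.to j))  ≈⟨ ∙-congˡ (to-index _) ⟩
      y ∙ (z ∙ B.to j)               ≈⟨ assoc y z _ ⟨
      (y ∙ z) ∙ B.to j               ≈⟨ ∙-congʳ yz≈ε ⟩
      ε ∙ B.to j                     ≈⟨ identityˡ _ ⟩
      B.to j                         ∎)) (index-to j)

  -- Reindexing along `translation` preserves the sum of all exponents, while by `exponent-shift`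
  -- each reindexed term is one short of the original. The `n` missing ones must therefore act
  -- trivially.
  order-kills : n · x ≈ ε
  order-kills = identityˡ-unique (n · x) (total · x) (begin
    n · x ∙ total · x                   ≈⟨ ×-homo-+ x n total ⟨
    (n ℕ.+ total) · x                   ≈⟨ E.∙-cong {n} {Σ.sum {n} (λ _ → 1)} {total} {Σ.sum (λ j → k (σ j))} (sym ones) (Σ.sum-permute k translation) ⟩
    (Σ.sum {n} (λ _ → 1) ℕ.+ Σ.sum (λ j → k (σ j))) · x
                                        ≈⟨ Σ.∑-distrib-+ {n} (λ _ → 1) (λ j → k (σ j)) ⟨
    Σ.sum (λ j → suc (k (σ j))) · x     ≈⟨ Σ.sum-cong-≋ {n} {λ j → suc (k (σ j))} {k} (λ j → exponent-shift (to-index (x ∙ B.to j))) ⟩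
    total · x                           ∎)
    where
    module E = CommutativeMonoid exponents
    module Σ = Sum exponents
    k : Fin n → ℕ
    k j = exponent (B.to j)
    σ : Fin n → Fin n
    σ = translation ⟨$⟩ʳ_
    total = Σ.sum k
    ×-1 : ∀ j → RawMonoidDefinitions._×_ E.rawMonoid j 1 ≡ j
    ×-1 zero    = ≡.refl
    ×-1 (suc j) = ≡.cong suc (×-1 j)
    ones : Σ.sum {n} (λ _ → 1) · x ≈ n · x
    ones = trans (Σ.sum-replicate n {1}) (×-congˡ (×-1 n))

-- Homomorphisms: compatibility with multiples and restriction to subgroups.

open RawMonoidDefinitions using () renaming (_×_ to _[_·_])

module _ (A : Group c ℓ) (B : Group c′ ℓ′) where
  private
    module A = Group A
    module B = Group B
  open GroupMorphisms A.rawGroup B.rawGroup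

  ·-homo : ∀ {φ} → IsGroupHomomorphism φ →
           ∀ n x → φ (A.rawMonoid [ n · x ]) B.≈ (B.rawMonoid [ n · φ x ])
  ·-homo hom zero    x = IsGroupHomomorphism.ε-homo hom
  ·-homo hom (suc n) x = B.trans (IsGroupHomomorphism.homo hom x _) (B.∙-congˡ (·-homo hom n x))

  restrict : (S : Subgroup A s) → ∀ {φ} → IsGroupHomomorphism φ →
             GroupMorphisms.IsGroupHomomorphism (Group.rawGroup (subgroup A S)) B.rawGroup (φ ∘ proj₁)
  restrict S hom = record
    { isMonoidHomomorphism = record
      { isMagmaHomomorphism = record
        { isRelHomomorphism = record { cong = H.⟦⟧-cong }
        ; homo = λ x y → H.homo (proj₁ x) (proj₁ y) }
      ; ε-homo = H.ε-homo }
    ; ⁻¹-homo = λ x → H.⁻¹-homo (proj₁ x) }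
    where module H = IsGroupHomomorphism hom

-- Torsion-freeness of `ℤ_P` and congruence modulo a number over `P`.

-- The factor `m` is invertible modulo powers of `q`, and cancelling `q ^ v` costs `v` digits. So
-- the hypothesis is read at level `n + v`, and compatibility brings the result down to level `n`.
p-adic-cancel : ∀ q → Prime q → ∀ v m → ¬ (q ℕ.∣ m) →
  (z : ℕ → ℤ) → (∀ {j k} → j ℕ.≤ k → + (q ^ j) ℤ.∣ ℤ.- z k ℤ.+ z j) →
  (∀ n → + (q ^ n) ℤ.∣ + (q ^ v ℕ.* m) ℤ.* z n) → ∀ n → + (q ^ n) ℤ.∣ z n
p-adic-cancel q pq v m q∤m z cz q^∣mz n = ≡.subst (+ (q ^ n) ℤ.∣_) (lemma (z n) (z (n ℕ.+ v)))
  (ℤ.∣m∣n⇒∣m+n q^n∣z (cz (ℕ.m≤m+n n v)))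
  where
  instance
    q≢0 : NonZero q
    q≢0 = prime⇒nonZero pq
    q^v≢0 : NonZero (q ^ v)
    q^v≢0 = ℕ.m^n≢0 q v
  lemma : ∀ a b → b ℤ.+ (ℤ.- b ℤ.+ a) ≡ a
  lemma = solve-∀
  q^n∣mz : + (q ^ (n ℕ.+ v)) ℤ.∣ + (q ^ v ℕ.* m) ℤ.* z (n ℕ.+ v) → + (q ^ n) ℤ.∣ + m ℤ.* z (n ℕ.+ v)
  q^n∣mz q^∣ = ℤ.*-cancelˡ-∣ (+ (q ^ v)) (≡.subst₂ ℤ._∣_
    (≡.trans (≡.cong (λ k → + (q ^ k)) (ℕ.+-comm n v)) (≡.trans (≡.cong +_ (ℕ.^-distribˡ-+-* q v n)) (ℤ.pos-* (q ^ v) (q ^ n))))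
    (≡.trans (≡.cong (ℤ._* z (n ℕ.+ v)) (ℤ.pos-* (q ^ v) m)) (ℤ.*-assoc (+ (q ^ v)) (+ m) (z (n ℕ.+ v))))
    q^∣)
  q^n∣z : + (q ^ n) ℤ.∣ z (n ℕ.+ v)
  q^n∣z = ∣ᵤ⇒∣ (ℤ.coprime-divisor (+ (q ^ n)) (+ m) (z (n ℕ.+ v)) (coprime-^ pq q∤m n)
    (∣⇒∣ᵤ (q^n∣mz (q^∣mz (n ℕ.+ v)))))

module ℤP {p : Level} (P : Pred ℕ p) (P-prime : ∀ {q} → P q → Prime q) (o : Level) where
  open Ẑ P P-prime o

  torsion-free : ∀ f .{{_ : NonZero f}} x y → f Z.· x Z.≈ f Z.· y → x Z.≈ y
  torsion-free f x y fx≈fy q = cancel (factorᵢ f q)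
    where
    z : Z.Carrier
    z = x Z.⁻¹ Z.∙ y
    lemma : ∀ f x y → ℤ.- (f ℤ.* x) ℤ.+ f ℤ.* y ≡ f ℤ.* (ℤ.- x ℤ.+ y)
    lemma = solve-∀
    f·z : ∀ k → + (value q ^ k) ℤ.∣ + f ℤ.* coord z q k
    f·z k = ≡.subst (+ (value q ^ k) ℤ.∣_)
      (≡.trans (≡.cong₂ (λ a b → ℤ.- a ℤ.+ b) (coord-· f x q k) (coord-· f y q k))
        (lemma (+ f) (coord x q k) (coord y q k)))
      (fx≈fy q k)
    cancel : (Σ[ v ∈ ℕ ] Σ[ m ∈ ℕ ] f ≡ value q ^ v ℕ.* m × ¬ (value q ℕ.∣ m)) →
             ∀ k → + (value q ^ k) ℤ.∣ coord z q k
    cancel (v , m , f≡ , q∤m) = p-adic-cancel (value q) (isPrime q) v m q∤m (coord z q) (proj₂ (z q))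
      (λ k → ≡.subst (λ n → + (value q ^ k) ℤ.∣ + n ℤ.* coord z q k) f≡ (f·z k))

  module _ (m : ℕ) .{{_ : NonZero m}} (m-over : ∀ q → Prime q → q ℕ.∣ m → P q) where

    -- P is not decidable, but the primes dividing m are, and they belong to P.
    primeDivisors : ∀ n → Σ[ F ∈ List (Refinement ℕ P) ] (∀ q → value q < n → value q ℕ.∣ m → q ∈ F)
    primeDivisors zero    = [] , λ _ ()
    primeDivisors (suc n) with F , F-all ← primeDivisors n | prime? n ×-dec (n ℕ.∣? m)
    ... | yes (n-prime , n∣m) = (n , [ m-over n n-prime n∣m ]) ∷ F , all
      where
      all : ∀ q → value q < suc n → value q ℕ.∣ m → q ∈ (n , [ m-over n n-prime n∣m ]) ∷ F
      all q q<1+n q∣m with ℕ.m≤n⇒m<n∨m≡n (ℕ.s≤s⁻¹ q<1+n)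
      ... | inj₁ q<n    = there (F-all q q<n q∣m)
      ... | inj₂ ≡.refl = here ≡.refl
    ... | no ¬prime-divisor = F , all
      where
      all : ∀ q → value q < suc n → value q ℕ.∣ m → q ∈ F
      all q q<1+n q∣m with ℕ.m≤n⇒m<n∨m≡n (ℕ.s≤s⁻¹ q<1+n)
      ... | inj₁ q<n    = F-all q q<n q∣m
      ... | inj₂ ≡.refl = contradiction (isPrime q , q∣m) ¬prime-divisor

    -- A prime not dividing `m` imposes a condition modulo `1` only, so finitely many coordinates
    -- decide divisibility by `m`.
    val≡0⊎∣ : ∀ q → (val m q ≡ 0) ⊎ (value q ℕ.∣ m)
    val≡0⊎∣ q with val m q | proj₁ (proj₂ (factorᵢ m q)) | proj₁ (proj₂ (proj₂ (factorᵢ m q)))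
    ... | zero  | _ | _  = inj₁ ≡.refl
    ... | suc v | k | eq = inj₂ (≡.subst (value q ℕ.∣_) (≡.sym eq)
                             (ℕ.∣-trans (ℕ.m∣m*n (value q ^ v)) (ℕ.m∣m*n k)))

    -- The coset of the multiples of `m` through `x`, written as a box so that it is visibly open.
    -- Prime divisors of `m` are at most `m`, hence the bound `suc m`.
    SameResidue : Z.Carrier → Pred Z.Carrier o
    SameResidue x = ⟦_⟧ (λ q → ℤ[ value q ] o) (Near m x (proj₁ (primeDivisors (suc m))))

    sameResidue-open : ∀ x → Z.IsOpen (SameResidue x)
    sameResidue-open x z z∈ = Near m x (proj₁ (primeDivisors (suc m))) , z∈ , id

    sameResidue-refl : ∀ x → SameResidue x x
    sameResidue-refl x = near-refl m x (proj₁ (primeDivisors (suc m)))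

    sameResidue⇒divisible : ∀ x z → SameResidue x z → ∃ λ y → m Z.· y Z.≈ x Z.⁻¹ Z.∙ z
    sameResidue⇒divisible x z z∈ = vanishes⇒divisible m (x Z.⁻¹ Z.∙ z) (λ q → vanishes q (val≡0⊎∣ q))
      where
      vanishes : ∀ q → (val m q ≡ 0) ⊎ (value q ℕ.∣ m) →
                 + (value q ^ val m q) ℤ.∣ coord (x Z.⁻¹ Z.∙ z) q (val m q)
      vanishes q (inj₁ v≡0) = ≡.subst (λ v → + (value q ^ v) ℤ.∣ coord (x Z.⁻¹ Z.∙ z) q (val m q))
        (≡.sym v≡0) (ℤ.∣ᵤ⇒∣ (ℕ.1∣ _))
      vanishes q (inj₂ q∣m) = near⇒ m x (proj₁ (primeDivisors (suc m))) z z∈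
        (proj₂ (primeDivisors (suc m)) q (ℕ.s≤s (ℕ.∣⇒≤ q∣m)) q∣m)

-- Transport to `Ω`, and positive multiples of `ω` in residue classes.

module ProcyclicGroup
  {p c ℓ o : Level} (P : Pred ℕ p) (P-prime : ∀ {q} → P q → Prime q)
  (Ω : TopologicalGroup c ℓ o) (Ω≅ : Ω ≅ ℤ⟨ P ⟩ o) where
  open TopologicalGroup Ω
  open _≅_ Ω≅
  open Ẑ P P-prime o
  open ℤP P P-prime o renaming (torsion-free to Z-torsion-free)
  open SetoidReasoning setoid
  private
    module To = ContinuousHom iso
    module From = ContinuousHom iso⁻¹

  to-injective : ∀ {x y} → to x Z.≈ to y → x ≈ y
  to-injective {x} {y} eq = begin
    x            ≈⟨ from∘to x ⟨
    from (to x)  ≈⟨ From.⟦⟧-cong {to x} {to y} eq ⟩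
    from (to y)  ≈⟨ from∘to y ⟩
    y            ∎

  abelianGroup : AbelianGroup c ℓ
  abelianGroup = record { isAbelianGroup = record { isGroup = isGroup ; comm = comm } }
    where
    comm : ∀ x y → x ∙ y ≈ y ∙ x
    comm x y = to-injective
      (≈-trans (to (x ∙ y)) (to x Z.∙ to y) (to (y ∙ x)) (To.homo x y)
        (≈-trans (to x Z.∙ to y) (to y Z.∙ to x) (to (y ∙ x)) (Z-comm (to x) (to y))
          (≈-sym (to (y ∙ x)) (to y Z.∙ to x) (To.homo y x))))

  torsion-free : ∀ f .{{_ : NonZero f}} {x y} → f · x ≈ f · y → x ≈ y
  torsion-free f {x} {y} fx≈fy = to-injective (Z-torsion-free f (to x) (to y)
    (≈-trans (f Z.· to x) (to (f · x)) (f Z.· to y)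
      (≈-sym (to (f · x)) (f Z.· to x) (·-homo group Z.group To.isHom f x))
      (≈-trans (to (f · x)) (to (f · y)) (f Z.· to y) (To.⟦⟧-cong fx≈fy) (·-homo group Z.group To.isHom f y))))

  open CommutativeMult (AbelianGroup.commutativeMonoid abelianGroup) using (×-congˡ; ×-homo-+; ×-assocˡ; ×-distrib-+)
  open GroupProperties group using (\\-leftDividesʳ; \\-leftDividesˡ)

  module _ (ω : Carrier) (m : ℕ) .{{_ : NonZero m}} where

    positive-multiple-mod : ∀ {x} n → (x ≈ n · ω) ⊎ (x ≈ (n · ω) ⁻¹) →
                            ∃ λ v → PositiveMultiple ω (x ∙ m · v)
    -- Adding `m · ω` makes the coefficient positive even when `n` is `0`.
    positive-multiple-mod {x} n (inj₁ x≈nω) = ω , n ℕ.+ m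
      , ℕ.≤-trans (ℕ.>-nonZero⁻¹ m) (ℕ.m≤n+m m n)
      , trans (∙-congʳ x≈nω) (sym (×-homo-+ ω n m))
    positive-multiple-mod {x} n (inj₂ x≈-nω) = suc n · ω , k
      , ℕ.≤-trans (ℕ.>-nonZero⁻¹ m) (ℕ.m≤m+n m _)
      , (begin
          x ∙ m · (suc n · ω)             ≈⟨ ∙-cong x≈-nω (×-assocˡ ω m (suc n)) ⟩
          (n · ω) ⁻¹ ∙ (m ℕ.* suc n) · ω  ≈⟨ ∙-congˡ (×-congˡ n+k≡m[1+n]) ⟨
          (n · ω) ⁻¹ ∙ (n ℕ.+ k) · ω      ≈⟨ ∙-congˡ (×-homo-+ ω n k) ⟩
          (n · ω) ⁻¹ ∙ (n · ω ∙ k · ω)    ≈⟨ \\-leftDividesʳ (n · ω) (k · ω) ⟩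
          k · ω                           ∎)
      where
      -- This is `m * suc n - n` without truncated subtraction. Adding `m * n` instead of
      -- `m * suc n` could leave the coefficient `0`, for instance when `m = 1`.
      k = m ℕ.+ ℕ.pred m ℕ.* n
      n+k≡m[1+n] : n ℕ.+ k ≡ m ℕ.* suc n
      n+k≡m[1+n] = E.begin
        n ℕ.+ (m ℕ.+ ℕ.pred m ℕ.* n)  E.≡⟨ ℕ.+-assoc n m _ ⟨
        (n ℕ.+ m) ℕ.+ ℕ.pred m ℕ.* n  E.≡⟨ ≡.cong (ℕ._+ ℕ.pred m ℕ.* n) (ℕ.+-comm n m) ⟩
        (m ℕ.+ n) ℕ.+ ℕ.pred m ℕ.* n  E.≡⟨ ℕ.+-assoc m n _ ⟩
        m ℕ.+ suc (ℕ.pred m) ℕ.* n    E.≡⟨ ≡.cong (λ w → m ℕ.+ w ℕ.* n) (ℕ.suc-pred m) ⟩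
        m ℕ.+ m ℕ.* n                 E.≡⟨ ℕ.*-suc m n ⟨
        m ℕ.* suc n                   E.∎
        where module E = ≡.≡-Reasoning

    module _ (m-over : ∀ q → Prime q → q ℕ.∣ m → P q) where

      Close : Carrier → Pred Carrier o
      Close u x = SameResidue m m-over (to u) (to x)

      close⇒divisible : ∀ u x → Close u x → ∃ λ v → u ∙ m · v ≈ x
      close⇒divisible u x x∈ = divisible (sameResidue⇒divisible m m-over (to u) (to x) x∈)
        where
        divisible : (∃ λ y → m Z.· y Z.≈ to u Z.⁻¹ Z.∙ to x) → ∃ λ v → u ∙ m · v ≈ x
        divisible (y , my≈) = from y , (begin
          u ∙ m · from y                        ≈⟨ ∙-congˡ (·-homo Z.group group From.isHom m y) ⟨
          u ∙ from (m Z.· y)                    ≈⟨ ∙-congˡ (From.⟦⟧-cong {m Z.· y} {to u Z.⁻¹ Z.∙ to x} my≈) ⟩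
          u ∙ from (to u Z.⁻¹ Z.∙ to x)         ≈⟨ ∙-congˡ (From.homo (to u Z.⁻¹) (to x)) ⟩
          u ∙ (from (to u Z.⁻¹) ∙ from (to x))  ≈⟨ ∙-congˡ (∙-cong (From.⁻¹-homo (to u)) (from∘to x)) ⟩
          u ∙ (from (to u) ⁻¹ ∙ x)              ≈⟨ ∙-congˡ (∙-congʳ (⁻¹-cong (from∘to u))) ⟩
          u ∙ (u ⁻¹ ∙ x)                        ≈⟨ \\-leftDividesˡ u x ⟩
          x                                     ∎)

      -- Density puts an integer multiple of `ω` into the open class of `u` modulo `m`; a second
      -- correction by a multiple of `m` makes its coefficient positive.
      positive-residue : IsTopologicalGenerator ω → ∀ u → ∃ λ v → PositiveMultiple ω (u ∙ m · v)
      positive-residue ω-generates u = combine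
        (ω-generates (Close u) (To.continuous {SameResidue m m-over (to u)} (sameResidue-open m m-over (to u)))
          u (sameResidue-refl m m-over (to u)))
        where
        combine : (∃ λ x → Close u x × ∃ λ n → (x ≈ n · ω) ⊎ (x ≈ (n · ω) ⁻¹)) →
                  ∃ λ v → PositiveMultiple ω (u ∙ m · v)
        combine (x , x∈ , n , x≈±nω) =
          let (y , u+my≈x)             = close⇒divisible u x x∈
              (v , k , 0<k , x+mv≈kω) = positive-multiple-mod n x≈±nω
          in y ∙ v , k , 0<k , (begin
            u ∙ m · (y ∙ v)      ≈⟨ ∙-congˡ (×-distrib-+ y v m) ⟩
            u ∙ (m · y ∙ m · v)  ≈⟨ assoc u _ _ ⟨
            (u ∙ m · y) ∙ m · v  ≈⟨ ∙-congʳ u+my≈x ⟩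
            x ∙ m · v            ≈⟨ x+mv≈kω ⟩
            k · ω                ∎)

-- Fibres of the projections as a basis of the topology of a pro-`P` group.

module ProfiniteGroup (P : Pred ℕ p) (G : TopologicalGroup c ℓ o) (G-pro : IsPro P G i) where
  open TopologicalGroup G
  open IsPro G-pro
  open InverseSystem system renaming (_≤_ to _≼_)
  open _≅_ isLimit
  private
    module To = ContinuousHom iso
    module From = ContinuousHom iso⁻¹
    module Limit = TopologicalGroup (limit o)

  π : ∀ l → Carrier → Obj.Carrier l
  π l x = proj₁ (to x) l

  π-hom : ∀ l → GroupMorphisms.IsGroupHomomorphism rawGroup (Obj.rawGroup l) (π l)
  π-hom l = record
    { isMonoidHomomorphism = record
      { isMagmaHomomorphism = record
        { isRelHomomorphism = record { cong = λ x≈y → To.⟦⟧-cong x≈y l }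
        ; homo = λ x y → To.homo x y l }
      ; ε-homo = To.ε-homo l }
    ; ⁻¹-homo = λ x → To.⁻¹-homo x l }

  -- By directedness one index `l` dominates the finitely many coordinates of the box, and for
  -- compatible families agreement at `l` descends to all of them. For the empty box any index will
  -- do.
  box-contains-fibre : ∀ F (x : Limit.Carrier) → ⟦_⟧ (λ j → discrete (obj j) o) F (proj₁ x) →
    ∃ λ l → ∀ (z : Limit.Carrier) → Obj._≈_ l (proj₁ x l) (proj₁ z l) →
    ⟦_⟧ (λ j → discrete (obj j) o) F (proj₁ z)
  box-contains-fibre []                         x _           = inhabitant , λ _ _ → tt
  box-contains-fibre ((j , V , lift V-resp) ∷ F) x (x∈V , x∈F) =
    let (k , fibre⊆F)    = box-contains-fibre F x x∈F
        (l , j≼l , k≼l)  = directed j k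
        down : ∀ {j} → j ≼ l → ∀ (z : Limit.Carrier) →
               Obj._≈_ l (proj₁ x l) (proj₁ z l) → Obj._≈_ j (proj₁ x j) (proj₁ z j)
        down {j} j≼l z x≈z = Obj.trans j (Obj.sym j (proj₂ x j≼l))
          (Obj.trans j (GroupMorphisms.IsGroupHomomorphism.⟦⟧-cong (φ-hom j≼l) x≈z) (proj₂ z j≼l))
    in l , λ z x≈z → V-resp (down j≼l z x≈z) x∈V , fibre⊆F z (down k≼l z x≈z)

  -- Pulled back along `from`, `V` is the trace of an open set of the product, which contains a box
  -- around `to x`.
  open-contains-fibre : ∀ {V} → IsOpen V → ∀ x → V x →
                        ∃ λ l → ∀ z → Obj._≈_ l (π l x) (π l z) → V z
  open-contains-fibre {V} V-open x x∈V = fibre (From.continuous V-open)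
    where
    fibre : Limit.IsOpen (V ∘ from) → ∃ λ l → ∀ z → Obj._≈_ l (π l x) (π l z) → V z
    fibre (W , W-open , V⊆W , W⊆V) =
      let (F , x∈F , F⊆W) = W-open (proj₁ (to x)) (V⊆W {to x} (open-resp-≈ V-open (sym (from∘to x)) x∈V))
          (l , fibre⊆F)   = box-contains-fibre F (to x) x∈F
      in l , λ z x≈z → open-resp-≈ V-open (from∘to z) (W⊆V {to z} (F⊆W (fibre⊆F (to z) x≈z)))

-- The homomorphism `d_H` and the Frobenius semigroup.

module FrobeniusProperties
  {p c ℓ c′ ℓ′ o : Level} (P : Pred ℕ p) (P-prime : ∀ {q} → P q → Prime q)
  (G : TopologicalGroup c ℓ o) (Ω : TopologicalGroup c′ ℓ′ o) (Ω≅ℤP : Ω ≅ ℤ⟨ P ⟩ o)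
  (ω : TopologicalGroup.Carrier Ω) (ω-generates : TopologicalGroup.IsTopologicalGenerator Ω ω)
  (d : ContinuousHom G Ω)
  (H : Subgroup (TopologicalGroup.group G) o) (H-finite : IsInertiallyFinite d H)
  where
  open Frobenius P P-prime {G} {Ω} Ω≅ℤP ω ω-generates d H H-finite
  open IsInertiallyFinite H-finite
  private
    module G = TopologicalGroup G
    module Ω = TopologicalGroup Ω
    module Hᵗ = TopologicalGroup Hᵗ
    module d = ContinuousHom d
  open ProcyclicGroup P P-prime Ω Ω≅ℤP
  open IndexDivision abelianGroup (image d H) degree hasIndex using (f≢0; index-kills)
  open CommutativeMult (AbelianGroup.commutativeMonoid abelianGroup)
    using (×-congʳ; ×-homo-+; ×-distrib-+)
  open SetoidReasoning Ω.setoid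
  private instance _ = f≢0

  -- `dH` is only known through `dH-spec`; torsion-freeness makes division by `degree` unambiguous,
  -- and the algebraic properties of `dH` follow from this.
  dH-unique : ∀ h {y} → d.to (proj₁ h) Ω.≈ degree Ω.· y → dH h Ω.≈ y
  dH-unique h dh≈fy = torsion-free degree (Ω.trans (dH-spec h) dh≈fy)

  dH-∙ : ∀ g h → dH (g Hᵗ.∙ h) Ω.≈ dH g Ω.∙ dH h
  dH-∙ g h = dH-unique (g Hᵗ.∙ h) (begin
    d.to (proj₁ g G.∙ proj₁ h)                   ≈⟨ d.homo (proj₁ g) (proj₁ h) ⟩
    d.to (proj₁ g) Ω.∙ d.to (proj₁ h)            ≈⟨ Ω.∙-cong (dH-spec g) (dH-spec h) ⟨
    degree Ω.· dH g Ω.∙ degree Ω.· dH h          ≈⟨ ×-distrib-+ (dH g) (dH h) degree ⟨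
    degree Ω.· (dH g Ω.∙ dH h)                   ∎)

  -- Equality in `Hᵗ` ignores the membership proofs, from which the value of `dH` is computed.
  dH-cong : ∀ {g h} → g Hᵗ.≈ h → dH g Ω.≈ dH h
  dH-cong {g} {h} g≈h = dH-unique g (Ω.trans (d.⟦⟧-cong g≈h) (Ω.sym (dH-spec h)))

  dH-hom : GroupMorphisms.IsGroupHomomorphism Hᵗ.rawGroup Ω.rawGroup dH
  dH-hom = record
    { isMonoidHomomorphism = record
      { isMagmaHomomorphism = record
        { isRelHomomorphism = record { cong = λ {g} {h} → dH-cong {g} {h} }
        ; homo = dH-∙ }
      ; ε-homo = dH-ε }
    ; ⁻¹-homo = λ h → GroupProperties.inverseˡ-unique Ω.group (dH (h Hᵗ.⁻¹)) (dH h)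
        (Ω.trans (Ω.sym (dH-∙ (h Hᵗ.⁻¹) h)) (Ω.trans (dH-cong {(h Hᵗ.⁻¹) Hᵗ.∙ h} {Hᵗ.ε} (Hᵗ.inverseˡ h)) dH-ε)) }
    where
    dH-ε : dH Hᵗ.ε Ω.≈ Ω.ε
    dH-ε = GroupProperties.identityʳ-unique Ω.group (dH Hᵗ.ε) (dH Hᵗ.ε)
      (Ω.trans (Ω.sym (dH-∙ Hᵗ.ε Hᵗ.ε)) (dH-cong {Hᵗ.ε Hᵗ.∙ Hᵗ.ε} {Hᵗ.ε} (Hᵗ.identityˡ Hᵗ.ε)))

  -- The group `Ω / d(H)` has order `degree`, so `degree · y` is some `d(h)` with `h` in `H`; then
  -- `dH h` is `y`.
  dH-surjective : ∀ y → ∃ λ h → dH h Ω.≈ y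
  dH-surjective y = let (g , g∈H , dg≈fy) = index-kills y in (g , g∈H) , dH-unique (g , g∈H) dg≈fy

  frob-subsemigroup : IsSubsemigroup Hᵗ.semigroup Frob
  frob-subsemigroup = record
    { resp     = λ {g} {h} g≈h (n , 0<n , dg≈nω) → n , 0<n , Ω.trans (dH-cong {h} {g} (Hᵗ.sym {g} {h} g≈h)) dg≈nω
    ; ∙-closed = λ {g} {h} (m , 0<m , dg≈mω) (n , _ , dh≈nω) →
        m ℕ.+ n , ℕ.≤-trans 0<m (ℕ.m≤m+n m n)
        , Ω.trans (dH-∙ g h) (Ω.trans (Ω.∙-cong dg≈mω dh≈nω) (Ω.sym (×-homo-+ ω m n)))
    }

  -- Frobenius elements in fibres, open sets and cosets.

  module _ {i} (G-pro : IsPro P G i) where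
    open IsPro G-pro
    open InverseSystem system
    open ProfiniteGroup P G G-pro

    -- Multiplying `g` by the `m`-th power of an element of `H` leaves its image in the group of
    -- order `m` unchanged, and shifts `dH g` by any prescribed element of `mΩ`.
    frob-in-fibre : ∀ l g → ∃ λ h → Frob h × Obj._≈_ l (π l (proj₁ g)) (π l (proj₁ h))
    frob-in-fibre l g =
      let (m , card , 0<m , m-over) = finite l
          instance _ = ℕ.>-nonZero 0<m
          (v , n , 0<n , eq) = positive-residue ω m m-over ω-generates (dH g)
          (h , dh≈v) = dH-surjective v
          πH-hom = restrict G.group (obj l) H (π-hom l)
          module πH = GroupMorphisms.IsGroupHomomorphism πH-hom
          πmh≈ε : Obj._≈_ l (π l (proj₁ (m Hᵗ.· h))) (Obj.ε l)
          πmh≈ε = Obj.trans l (·-homo Hᵗ.group (obj l) πH-hom m h)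
            (Lagrange.order-kills (obj l) card (π l (proj₁ h)))
      in g Hᵗ.∙ m Hᵗ.· h
       , (n , 0<n , (begin
           dH (g Hᵗ.∙ m Hᵗ.· h)        ≈⟨ dH-∙ g (m Hᵗ.· h) ⟩
           dH g Ω.∙ dH (m Hᵗ.· h)      ≈⟨ Ω.∙-congˡ (·-homo Hᵗ.group Ω.group dH-hom m h) ⟩
           dH g Ω.∙ m Ω.· dH h         ≈⟨ Ω.∙-congˡ (×-congʳ m dh≈v) ⟩
           dH g Ω.∙ m Ω.· v            ≈⟨ eq ⟩
           n Ω.· ω                     ∎))
       , Obj.sym l (Obj.trans l (πH.homo g (m Hᵗ.· h))
           (Obj.trans l (Obj.∙-congˡ l πmh≈ε) (Obj.identityʳ l _)))

    open-contains-fibreᴴ : ∀ {V} → Hᵗ.IsOpen V → ∀ x → V x →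
                           ∃ λ l → ∀ z → Obj._≈_ l (π l (proj₁ x)) (π l (proj₁ z)) → V z
    open-contains-fibreᴴ (W , W-open , V⊆W , W⊆V) x x∈V =
      let (l , fibre⊆W) = open-contains-fibre W-open (proj₁ x) (V⊆W x∈V)
      in l , λ z x≈z → W⊆V (fibre⊆W (proj₁ z) x≈z)

    frob-dense : Hᵗ.IsDense Frob
    frob-dense V V-open x x∈V =
      let (l , fibre⊆V) = open-contains-fibreᴴ V-open x x∈V
          (h , h∈Frob , x≈h) = frob-in-fibre l x
      in h , fibre⊆V h x≈h , h∈Frob

    -- Some fibre over the identity lies in `U`. If `h` and `x` have the same image under `π l`,
    -- then the quotient of `x` by `h` lies in that fibre.
    frob-meets-cosets : (U : Subgroup Hᵗ.group o) → Hᵗ.IsOpen (Subgroup.Member U) →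
                        ∀ x → ∃ λ h → Frob h × Subgroup.Member U (h Hᵗ.⁻¹ Hᵗ.∙ x)
    frob-meets-cosets U U-open x =
      let (l , fibre⊆U) = open-contains-fibreᴴ U-open Hᵗ.ε (Subgroup.ε-closed U)
          (h , h∈Frob , x≈h) = frob-in-fibre l x
          module πH = GroupMorphisms.IsGroupHomomorphism (restrict G.group (obj l) H (π-hom l))
      in h , h∈Frob , fibre⊆U (h Hᵗ.⁻¹ Hᵗ.∙ x)
           (Obj.trans l πH.ε-homo (Obj.sym l
             (Obj.trans l (πH.homo (h Hᵗ.⁻¹) x)
               (Obj.trans l (Obj.∙-cong l (πH.⁻¹-homo h) x≈h) (Obj.inverseˡ l _)))))

-- Density of Frobenius elements and surjectivity onto finite quotients.

theorem4p4p6 :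
    {p c ℓ c′ ℓ′ o i : Level}
    (P : Pred ℕ p) (P-prime : ∀ {q} → P q → Prime q)
    (G : TopologicalGroup c ℓ o) (G-pro : IsPro P G i)
    (Ω : TopologicalGroup c′ ℓ′ o) (Ω≅ℤP : Ω ≅ ℤ⟨ P ⟩ o)
    (ω : TopologicalGroup.Carrier Ω) (ω-generates : TopologicalGroup.IsTopologicalGenerator Ω ω)
    (d : ContinuousHom G Ω)
    (d-surjective : Surjective (TopologicalGroup._≈_ G) (TopologicalGroup._≈_ Ω) (ContinuousHom.to d))
    (H : Subgroup (TopologicalGroup.group G) o) (H-finite : IsInertiallyFinite d H) →
    let open Frobenius P P-prime {G} {Ω} Ω≅ℤP ω ω-generates d H H-finite
        module Hᵗ = TopologicalGroup Hᵗ
    in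
    Σ[ Frob-sub ∈ IsSubsemigroup Hᵗ.semigroup Frob ]
      Hᵗ.IsDense Frob ×
      ((U : Subgroup Hᵗ.group o) (U-normal : Subgroup.IsNormal U) → Hᵗ.IsOpen (Subgroup.Member U) →
        let FrobH = IsSubsemigroup.subsemigroup Frob-sub
            H/U = quotient Hᵗ.group U U-normal
            q = quotientMap Hᵗ.group U U-normal
        in
        MagmaMorphisms.IsMagmaHomomorphism (Semigroup.rawMagma FrobH) (Group.rawMagma H/U) (q ∘ proj₁) ×
        Surjective (Semigroup._≈_ FrobH) (Group._≈_ H/U) (q ∘ proj₁))
theorem4p4p6 P P-prime G G-pro Ω Ω≅ℤP ω ω-generates d _ H H-finite =
  frob-subsemigroup , frob-dense G-pro , λ U U-normal U-open →
    let module U = Subgroup U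
        module H/U = Group (quotient Hᵗ.group U U-normal)
        ≈⇒~ : ∀ {x y} → x Hᵗ.≈ y → x H/U.≈ y
        ≈⇒~ {x} {y} x≈y = U.resp {Hᵗ.ε} {x Hᵗ.⁻¹ Hᵗ.∙ y}
          (Hᵗ.trans {Hᵗ.ε} {x Hᵗ.⁻¹ Hᵗ.∙ x} {x Hᵗ.⁻¹ Hᵗ.∙ y} (Hᵗ.sym {x Hᵗ.⁻¹ Hᵗ.∙ x} {Hᵗ.ε} (Hᵗ.inverseˡ x))
            (Hᵗ.∙-congˡ {x Hᵗ.⁻¹} {x} {y} x≈y)) U.ε-closed
    in record { isRelHomomorphism = record { cong = λ {x} {y} → ≈⇒~ {proj₁ x} {proj₁ y} }
              ; homo = λ x y → H/U.refl {proj₁ x Hᵗ.∙ proj₁ y} }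
     , λ x → let (h , h∈Frob , h~x) = frob-meets-cosets G-pro U U-open x
             -- `Surjective` asks for the value at every `z` equal to the chosen preimage, so
             -- equality is first turned into membership in the same coset.
             in (h , h∈Frob) , λ {z} z≈h → H/U.trans {proj₁ z} {h} {x} (≈⇒~ {proj₁ z} {h} z≈h) h~x
  where
  open Frobenius P P-prime {G} {Ω} Ω≅ℤP ω ω-generates d H H-finite using (Hᵗ)
  open FrobeniusProperties P P-prime G Ω Ω≅ℤP ω ω-generates d H H-finite
  module Hᵗ = TopologicalGroup Hᵗ
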